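{- Every rigidity circuit $C$ has a resultant tree. That is, for every rigidity circuit $C$ with $n$ vertices there is a rooted binary tree $T_C$ with root $C$ such that: (a) every node of $T_C$ is a rigidity circuit; (b) every circuit at level $l$ of $T_C$ (the root being at level $0$) has at most $n-l$ vertices; (c) every internal node $C_i$ has exactly two children $C_j, C_k$, and there is a common edge $e\in E(C_j)\cap E(C_k)$ with $C_i=\mathrm{CR}(C_j,C_k,e)$; (d) every leaf is a complete graph $K_4$. In particular every rigidity circuit can be obtained from copies of $K_4$ by repeated combinatorial resultant operations.
   Context: All graphs are finite and simple; a graph is given by a set of edges, and its vertex set is the set of endpoints of its edges. A graph $G=(V,E)$ is $(2,3)$-sparse if every subset $V'\subseteq V$ with $|V'|\ge 2$ spans at most $2|V'|-3$ edges. A Laman graph is a $(2,3)$-sparse graph with $|E|=2|V|-3$. A rigidity circuit (also called sparsity circuit) is a graph $C=(V,E)$ with $|E|=2|V|-2$ such that every proper subset $V'\subsetneq V$ with $|V'|\ge 2$ spans at most $2|V'|-3$ edges; equivalently, a minimal edge set which is not $(2,3)$-sparse (a circuit of the $(2,3)$-sparsity matroid on the edges of $K_n$). Combinatorial resultant: for two distinct graphs $G_1=(V_1,E_1)$, $G_2=(V_2,E_2)$ and a common edge $e\in E_1\cap E_2$, $\mathrm{CR}(G_1,G_2,e)$ is the graph with vertex set $V_1\cup V_2$ and edge set $(E_1\cup E_2)\setminus\{e\}$. -}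

module Defs where

open import Data.Bool using (Bool; false; T)
open import Data.Bool.Properties using (T?)
open import Data.Fin using (Fin; _<?_)
open import Data.Fin.Properties using (any?)
open import Data.Fin.Subset using (Subset; _∈_; _⊂_; _∪_; ∣_∣)
open import Data.Fin.Subset.Properties using (_∈?_)
open import Data.List using (List; length; filter; allFin; cartesianProduct)
open import Data.Nat using (ℕ; zero; suc; _+_; _*_; _≤_)
open import Data.Product using (_×_; _,_; ∃-syntax)
open import Data.Sum using (_⊎_)
open import Data.Vec using (tabulate)
open import Function.Bundles using (_⇔_)
open import Relation.Binary.PropositionalEquality using (_≡_; _≢_)
open import Relation.Nullary using (¬_; Dec; does)
open import Relation.Nullary.Decidable using (_×-dec_)

-- A finite simple graph whose edges are edges of the complete graph on Fin N.
-- Fin N is only a supply of labels: the vertex set is V G below.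
record Graph (N : ℕ) : Set where
  field
    adj        : Fin N → Fin N → Bool
    adj-sym    : ∀ x y → adj x y ≡ adj y x
    adj-irrefl : ∀ x → adj x x ≡ false

open Graph public

module _ {N : ℕ} where

  Adj : Graph N → Fin N → Fin N → Set
  Adj G x y = T (adj G x y)

  Adj? : ∀ G x y → Dec (Adj G x y)
  Adj? G x y = T? (adj G x y)

  infix 4 _≈_

  _≈_ : Graph N → Graph N → Set
  G ≈ H = ∀ x y → adj G x y ≡ adj H x y

  -- Each edge is listed once, with its endpoints in increasing order.
  E : Graph N → List (Fin N × Fin N)
  E G = filter (λ (x , y) → (x <? y) ×-dec Adj? G x y)
               (cartesianProduct (allFin N) (allFin N))

  V : Graph N → Subset N
  V G = tabulate (λ x → does (any? (Adj? G x)))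

  spanned : Graph N → Subset N → List (Fin N × Fin N)
  spanned G S = filter (λ (x , y) → (x ∈? S) ×-dec (y ∈? S)) (E G)

  -- |E| = 2|V| - 2 and |E(S)| ≤ 2|S| - 3, written without truncated subtraction.
  record IsRigidityCircuit (G : Graph N) : Set where
    field
      edge-count : length (E G) + 2 ≡ 2 * ∣ V G ∣
      sparse     : ∀ S → S ⊂ V G → 2 ≤ ∣ S ∣ →
                   length (spanned G S) + 3 ≤ 2 * ∣ S ∣

  record IsK₄ (G : Graph N) : Set where
    field
      order    : ∣ V G ∣ ≡ 4
      complete : ∀ x y → x ∈ V G → y ∈ V G → x ≢ y → Adj G x y

  SameEdge : Fin N × Fin N → Fin N × Fin N → Set
  SameEdge (x , y) (u , v) = (x ≡ u × y ≡ v) ⊎ (x ≡ v × y ≡ u)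

  -- G = CR(G₁, G₂, uv).  The vertex set is specified separately because deleting
  -- uv could leave an isolated vertex, in which case V G ≢ V G₁ ∪ V G₂.
  record IsCR (G G₁ G₂ : Graph N) (u v : Fin N) : Set where
    field
      distinct : ¬ (G₁ ≈ G₂)
      common₁  : Adj G₁ u v
      common₂  : Adj G₂ u v
      vertices : V G ≡ V G₁ ∪ V G₂
      edges    : ∀ x y → Adj G x y ⇔
                 ((Adj G₁ x y ⊎ Adj G₂ x y) × ¬ SameEdge (x , y) (u , v))

data Tree (N : ℕ) : Set where
  leaf : Graph N → Tree N
  node : Graph N → Tree N → Tree N → Tree N

module _ {N : ℕ} where

  root : Tree N → Graph N
  root (leaf G)     = G
  root (node G _ _) = G

  -- s ⊑[ l ] t : an occurrence of s as the subtree of t at a node of level l.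
  infix 4 _⊑[_]_

  data _⊑[_]_ (s : Tree N) : ℕ → Tree N → Set where
    here  : s ⊑[ zero ] s
    left  : ∀ {l G t₁ t₂} → s ⊑[ l ] t₁ → s ⊑[ suc l ] node G t₁ t₂
    right : ∀ {l G t₁ t₂} → s ⊑[ l ] t₂ → s ⊑[ suc l ] node G t₁ t₂

  record IsResultantTree (C : Graph N) (t : Tree N) : Set where
    field
      root-is-C : root t ≡ C
      circuits  : ∀ {l s} → s ⊑[ l ] t → IsRigidityCircuit (root s)
      levels    : ∀ {l s} → s ⊑[ l ] t → ∣ V (root s) ∣ + l ≤ ∣ V C ∣
      internal  : ∀ {l G t₁ t₂} → node G t₁ t₂ ⊑[ l ] t →
                  ∃[ u ] ∃[ v ] IsCR G (root t₁) (root t₂) u v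
      leaves    : ∀ {l G} → leaf G ⊑[ l ] t → IsK₄ G

  data ObtainableFromK₄ : Graph N → Set where
    base : ∀ {G} → IsK₄ G → ObtainableFromK₄ G
    step : ∀ {G G₁ G₂ u v} → ObtainableFromK₄ G₁ → ObtainableFromK₄ G₂ →
           IsCR G G₁ G₂ u v → ObtainableFromK₄ G

{-# OPTIONS --safe #-}
module Submission where

open import Algebra.Properties.CommutativeMonoid.Sum using ()
open import Data.Bool using (Bool; true; false; _∧_; _∨_; T)
open import Data.Bool.Properties using (T-≡; T-∧; T-∨; ∧-assoc; ∧-comm; ∧-zeroʳ; ∨-comm)
open import Data.Empty using (⊥; ⊥-elim)
open import Data.Fin using (Fin; zero; suc; _<?_)
open import Data.Fin.Properties using (_≟_; <-cmp; any?)
open import Data.Fin.Subset using (Subset; _∈_; _∉_; _⊂_; _⊆_; _∪_; _∩_; _-_; ⁅_⁆; ∣_∣)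
open import Data.Fin.Subset.Induction using (⊂-wellFounded; Acc; acc)
open import Data.Fin.Subset.Properties
open import Data.List using ([]; _∷_; _++_; length; filter; map; allFin; cartesianProduct)
import Data.List as List
open import Data.List.Properties using (map-++; map-tabulate; map-∘; filter-all; filter-none)
open import Data.List.Relation.Unary.All as All using ()
open import Data.List.Relation.Unary.All.Properties using (all-filter)
open import Data.Nat using (ℕ; zero; suc; _+_; _*_; _∸_; _≤_; _<_; z≤n; s≤s; _≤?_)
open import Data.Nat.Induction using (<-wellFounded)
import Data.Nat.ListAction as ListAction
import Data.Nat.ListAction.Properties as ListAction
open import Data.Nat.Properties using (+-0-commutativeMonoid; +-cancelʳ-≤; +-mono-≤; +-identityʳ; *-cancelˡ-≤; ≤-refl; ≤-reflexive; ≤-trans; module ≤-Reasoning)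
import Data.Nat.Properties as ℕ
open import Data.Nat.Tactic.RingSolver using (solve-∀)
open import Data.Product using (_×_; _,_; proj₁; proj₂; ∃-syntax; swap)
open import Data.Sum using (_⊎_; inj₁; inj₂)
open import Data.Vec using ([]; _∷_; lookup; tabulate; here; there)
open import Data.Vec.Properties using (lookup-zipWith; lookup∘tabulate; []=⇒lookup; lookup⇒[]=)
open import Function using (_∘_; id; Equivalence; mk⇔)
open import Relation.Binary.Definitions using (tri<; tri≈; tri>)
open import Relation.Binary.PropositionalEquality
open import Relation.Nullary using (¬_; Dec; yes; no; does; contradiction)
open import Relation.Nullary.Decidable using (True; toWitness; _×-dec_; map′; dec-true; dec-false; ¬?; decidable-stable)
open import Defs
open Algebra.Properties.CommutativeMonoid.Sum +-0-commutativeMonoid using (sum; sum-syntax; ∑-comm; ∑-distrib-+; sum-cong-≗)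

-- Call S tight if it spans 2|S| - 3 edges.  The degrees of C sum to 4|V| - 4 and are at least 3,
-- so C has at least four vertices of degree 3.  If these are pairwise adjacent, C is a K₄.
-- Otherwise let v, w be nonadjacent of degree 3 and W = V - v - w.  Some pair x, y of neighbours
-- of v lies in no tight subset of W: if all three pairs did, the union of the three tight sets
-- would contain a tight U ⊆ W with all neighbours of v, and U + v would violate sparsity.
-- Since V - v and V - w are tight, take minimal tight X₁ ⊆ V - v and X₂ ⊆ V - w containing x, y;
-- by minimality C[Xᵢ] + xy are circuits.  As X₁ ∩ X₂ ⊆ W is not tight, supermodularity of the
-- number of spanned edges gives X₁ ∪ X₂ = V with no edge crossing between X₁ and X₂, that is,
-- C is the resultant of the two circuits along xy.

-- Cancellation, Boolean truth tables and finite double sums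

-- Linear arithmetic over the naturals without subtraction: the hypotheses of an argument are added
-- up to `a ≤ b`, and the terms common to both sides are collected in `c`, leaving the ring solver
-- to check the two equations.
cancel-common : ∀ {a b l r} c → a ≤ b → a ≡ l + c → b ≡ r + c → l ≤ r
cancel-common c a≤b refl refl = +-cancelʳ-≤ c _ _ a≤b

allBool? : {P : Bool → Set} → (∀ b → Dec (P b)) → Dec (∀ b → P b)
allBool? P? = map′ (λ { (t , f) true → t ; (t , f) false → f }) (λ h → h true , h false)
                   (P? true ×-dec P? false)

-- For a closed decidable statement about Booleans, `True A?` evaluates to the unit type, so
-- evaluation of the whole truth table is the proof.
by-table : {A : Set} (A? : Dec A) {_ : True A?} → A
by-table A? {true-table} = toWitness true-table

T-does⁻ : {A : Set} (A? : Dec A) → T (does A?) → A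
T-does⁻ (yes a) _ = a

T-does⁺ : {A : Set} (A? : Dec A) → A → T (does A?)
T-does⁺ A? a = Equivalence.from T-≡ (dec-true A? a)

-- The Iverson bracket, through which cardinalities and edge counts become sums of indicators.
⟦_⟧ : Bool → ℕ
⟦ true  ⟧ = 1
⟦ false ⟧ = 0

∑-mono-≤ : ∀ {n} {f g : Fin n → ℕ} → (∀ x → f x ≤ g x) → sum f ≤ sum g
∑-mono-≤ {zero}  f≤g = z≤n
∑-mono-≤ {suc n} f≤g = +-mono-≤ (f≤g zero) (∑-mono-≤ (f≤g ∘ suc))

∑-zero : ∀ n → ∑[ x < n ] 0 ≡ 0
∑-zero zero    = refl
∑-zero (suc n) = ∑-zero n

∑-δ : ∀ {n} (a : Fin n) (f : Fin n → Bool) → ∑[ x < n ] ⟦ does (x ≟ a) ∧ f x ⟧ ≡ ⟦ f a ⟧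
∑-δ {suc n} zero    f = trans (cong (⟦ f zero ⟧ +_) (∑-zero n)) (+-identityʳ _)
∑-δ {suc n} (suc a) f = ∑-δ a (f ∘ suc)

∑∑ : ∀ {n} → (Fin n → Fin n → ℕ) → ℕ
∑∑ {n} f = ∑[ x < n ] ∑[ y < n ] f x y

∑∑-distrib-+ : ∀ {n} (f g : Fin n → Fin n → ℕ) → ∑∑ (λ x y → f x y + g x y) ≡ ∑∑ f + ∑∑ g
∑∑-distrib-+ {n} f g = trans (sum-cong-≗ λ x → ∑-distrib-+ (f x) (g x)) (∑-distrib-+ (λ x → sum (f x)) (λ x → sum (g x)))

∑∑-cong : ∀ {n} {f g : Fin n → Fin n → ℕ} → (∀ x y → f x y ≡ g x y) → ∑∑ f ≡ ∑∑ g
∑∑-cong f≡g = sum-cong-≗ λ x → sum-cong-≗ (f≡g x)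

∑∑-mono-≤ : ∀ {n} {f g : Fin n → Fin n → ℕ} → (∀ x y → f x y ≤ g x y) → ∑∑ f ≤ ∑∑ g
∑∑-mono-≤ f≤g = ∑-mono-≤ λ x → ∑-mono-≤ (f≤g x)

∑∑-δˡ : ∀ {n} (a : Fin n) (f : Fin n → Fin n → Bool) →
        ∑∑ (λ x y → ⟦ does (x ≟ a) ∧ f x y ⟧) ≡ ∑[ y < n ] ⟦ f a y ⟧
∑∑-δˡ {n} a f = trans (∑-comm (λ x y → ⟦ does (x ≟ a) ∧ f x y ⟧)) (sum-cong-≗ λ y → ∑-δ a (λ x → f x y))

-- Cardinalities of subsets

∣∣-∑ : ∀ {n} (S : Subset n) → ∣ S ∣ ≡ ∑[ x < n ] ⟦ lookup S x ⟧
∣∣-∑ []          = refl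
∣∣-∑ (true  ∷ S) = cong suc (∣∣-∑ S)
∣∣-∑ (false ∷ S) = ∣∣-∑ S

∉⇒lookup : ∀ {n} {x : Fin n} {S : Subset n} → x ∉ S → lookup S x ≡ false
∉⇒lookup {x = x} {S} x∉S with lookup S x in eq
... | true  = contradiction (lookup⇒[]= x S eq) x∉S
... | false = refl

does-∈? : ∀ {n} (x : Fin n) (S : Subset n) → does (x ∈? S) ≡ lookup S x
does-∈? x S with x ∈? S
... | yes x∈S = sym ([]=⇒lookup x∈S)
... | no  x∉S = sym (∉⇒lookup x∉S)

lookup-⁅⁆ : ∀ {n} (a x : Fin n) → lookup ⁅ a ⁆ x ≡ does (x ≟ a)
lookup-⁅⁆ a x with x ≟ a
... | yes refl = []=⇒lookup (x∈⁅x⁆ a)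
... | no  x≢a  = ∉⇒lookup (x≢y⇒x∉⁅y⁆ x≢a)

lookup-∪ : ∀ {n} (A B : Subset n) x → lookup (A ∪ B) x ≡ lookup A x ∨ lookup B x
lookup-∪ A B x = lookup-zipWith _∨_ x A B

lookup-∩ : ∀ {n} (A B : Subset n) x → lookup (A ∩ B) x ≡ lookup A x ∧ lookup B x
lookup-∩ A B x = lookup-zipWith _∧_ x A B

∣∪∣+∣∩∣ : ∀ {n} (A B : Subset n) → ∣ A ∪ B ∣ + ∣ A ∩ B ∣ ≡ ∣ A ∣ + ∣ B ∣
∣∪∣+∣∩∣ []          []          = refl
∣∪∣+∣∩∣ (true  ∷ A) (true  ∷ B) = cong suc (trans (ℕ.+-suc _ _) (trans (cong suc (∣∪∣+∣∩∣ A B)) (sym (ℕ.+-suc _ _))))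
∣∪∣+∣∩∣ (true  ∷ A) (false ∷ B) = cong suc (∣∪∣+∣∩∣ A B)
∣∪∣+∣∩∣ (false ∷ A) (true  ∷ B) = trans (cong suc (∣∪∣+∣∩∣ A B)) (sym (ℕ.+-suc _ _))
∣∪∣+∣∩∣ (false ∷ A) (false ∷ B) = ∣∪∣+∣∩∣ A B

∣∪⁅⁆∣ : ∀ {n} {S : Subset n} {a} → a ∉ S → ∣ S ∪ ⁅ a ⁆ ∣ ≡ suc ∣ S ∣
∣∪⁅⁆∣ {n} {S = S} {a} a∉S = begin
  ∣ S ∪ ⁅ a ⁆ ∣                     ≡⟨ +-identityʳ _ ⟨
  ∣ S ∪ ⁅ a ⁆ ∣ + 0                 ≡⟨ cong (∣ S ∪ ⁅ a ⁆ ∣ +_) disjoint ⟨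
  ∣ S ∪ ⁅ a ⁆ ∣ + ∣ S ∩ ⁅ a ⁆ ∣     ≡⟨ ∣∪∣+∣∩∣ S ⁅ a ⁆ ⟩
  ∣ S ∣ + ∣ ⁅ a ⁆ ∣                 ≡⟨ cong (∣ S ∣ +_) (∣⁅x⁆∣≡1 a) ⟩
  ∣ S ∣ + 1                         ≡⟨ ℕ.+-comm _ 1 ⟩
  suc ∣ S ∣ ∎
  where
  open ≡-Reasoning
  disjoint : ∣ S ∩ ⁅ a ⁆ ∣ ≡ 0
  disjoint = trans (cong ∣_∣ (Empty-unique {p = S ∩ ⁅ a ⁆} λ (x , x∈) →
    let x∈S , x∈a = x∈p∩q⁻ S ⁅ a ⁆ x∈ in a∉S (subst (_∈ S) (x∈⁅y⁆⇒x≡y a x∈a) x∈S))) (∣⊥∣≡0 n)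

x∉p-x : ∀ {n} (p : Subset n) x → x ∉ p - x
x∉p-x (_ ∷ p) zero    ()
x∉p-x (_ ∷ p) (suc x) (there x∈) = x∉p-x p x x∈

x∈p-y⁻ : ∀ {n} (p : Subset n) {x} y → x ∈ p - y → x ∈ p × x ≢ y
x∈p-y⁻ p y x∈ = p─q⊆p p ⁅ y ⁆ x∈ , λ { refl → x∉p-x p y x∈ }

p-x∪⁅x⁆ : ∀ {n} {p : Subset n} {x} → x ∈ p → (p - x) ∪ ⁅ x ⁆ ≡ p
p-x∪⁅x⁆ {p = p} {x} x∈p = ⊆-antisym to from
  where
  to : (p - x) ∪ ⁅ x ⁆ ⊆ p
  to y∈ with x∈p∪q⁻ (p - x) ⁅ x ⁆ y∈
  ... | inj₁ y∈p-x = proj₁ (x∈p-y⁻ p x y∈p-x)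
  ... | inj₂ y∈x   = subst (_∈ p) (sym (x∈⁅y⁆⇒x≡y x y∈x)) x∈p
  from : p ⊆ (p - x) ∪ ⁅ x ⁆
  from {y} y∈p with y ≟ x
  ... | yes refl = x∈p∪q⁺ (inj₂ (x∈⁅x⁆ x))
  ... | no  y≢x  = x∈p∪q⁺ (inj₁ (x∈p∧x≢y⇒x∈p-y y∈p y≢x))

∣p∣≡1+∣p-x∣ : ∀ {n} {p : Subset n} {x} → x ∈ p → ∣ p ∣ ≡ suc ∣ p - x ∣
∣p∣≡1+∣p-x∣ {p = p} {x} x∈p = trans (cong ∣_∣ (sym (p-x∪⁅x⁆ x∈p))) (∣∪⁅⁆∣ (x∉p-x p x))

pick : ∀ {n k} (p : Subset n) → suc k ≤ ∣ p ∣ → ∃[ x ] x ∈ p × k ≤ ∣ p - x ∣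
pick {n} p k<∣p∣ with nonempty? p
... | yes (x , x∈p) = x , x∈p , ℕ.≤-pred (subst (_ ≤_) (∣p∣≡1+∣p-x∣ x∈p) k<∣p∣)
... | no  empty     = contradiction (subst (_ ≤_) (trans (cong ∣_∣ (Empty-unique empty)) (∣⊥∣≡0 n)) k<∣p∣) λ ()

pick₃ : ∀ {n} (p : Subset n) → 3 ≤ ∣ p ∣ →
  ∃[ a ] ∃[ b ] ∃[ c ] a ∈ p × b ∈ p × c ∈ p × a ≢ b × a ≢ c × b ≢ c
pick₃ p 3≤∣p∣ =
  let a , a∈p , 2≤     = pick {k = 2} p 3≤∣p∣
      b , b∈p-a , 1≤   = pick {k = 1} (p - a) 2≤
      c , c∈p-a-b , _  = pick {k = 0} (p - a - b) 1≤
      b∈p , b≢a        = x∈p-y⁻ p a b∈p-a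
      c∈p-a , c≢b      = x∈p-y⁻ (p - a) b c∈p-a-b
      c∈p , c≢a        = x∈p-y⁻ p a c∈p-a
  in a , b , c , a∈p , b∈p , c∈p , b≢a ∘ sym , c≢a ∘ sym , c≢b ∘ sym

2≤∣p∣ : ∀ {n} {p : Subset n} {x y} → x ∈ p → y ∈ p → x ≢ y → 2 ≤ ∣ p ∣
2≤∣p∣ {p = p} {x} {y} x∈p y∈p x≢y = begin
  2                  ≡⟨ cong suc (∣⁅x⁆∣≡1 y) ⟨
  suc ∣ ⁅ y ⁆ ∣      ≤⟨ s≤s (p⊆q⇒∣p∣≤∣q∣ λ z∈y → subst (_∈ p - x) (sym (x∈⁅y⁆⇒x≡y y z∈y)) (x∈p∧x≢y⇒x∈p-y y∈p (x≢y ∘ sym))) ⟩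
  suc ∣ p - x ∣      ≡⟨ ∣p∣≡1+∣p-x∣ x∈p ⟨
  ∣ p ∣              ∎
  where open ≤-Reasoning

⊆∧⊄⇒≡ : ∀ {n} {p q : Subset n} → p ⊆ q → ¬ (p ⊂ q) → p ≡ q
⊆∧⊄⇒≡ {p = p} {q} p⊆q p⊄q = ⊆-antisym p⊆q q⊆p
  where
  q⊆p : q ⊆ p
  q⊆p {x} x∈q with x ∈? p
  ... | yes x∈p = x∈p
  ... | no  x∉p = ⊥-elim (p⊄q (p⊆q , x , x∈q , x∉p))

∪-⊆ : ∀ {n} {p q r : Subset n} → p ⊆ r → q ⊆ r → p ∪ q ⊆ r
∪-⊆ {p = p} {q} p⊆r q⊆r x∈ with x∈p∪q⁻ p q x∈
... | inj₁ x∈p = p⊆r x∈p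
... | inj₂ x∈q = q⊆r x∈q

-- Numbers of spanned edges

length-filter² : ∀ {A : Set} {P Q : A → Set} (P? : ∀ x → Dec (P x)) (Q? : ∀ x → Dec (Q x)) xs →
  length (filter Q? (filter P? xs)) ≡ ListAction.sum (map (λ x → ⟦ does (P? x) ∧ does (Q? x) ⟧) xs)
length-filter² P? Q? []       = refl
length-filter² P? Q? (x ∷ xs) with does (P? x)
... | false = length-filter² P? Q? xs
... | true with does (Q? x)
...   | false = length-filter² P? Q? xs
...   | true  = cong suc (length-filter² P? Q? xs)

sum-cartesianProduct : ∀ {A B : Set} (f : A × B → ℕ) xs ys →
  ListAction.sum (map f (cartesianProduct xs ys)) ≡
  ListAction.sum (map (λ x → ListAction.sum (map (λ y → f (x , y)) ys)) xs)
sum-cartesianProduct f []       ys = refl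
sum-cartesianProduct f (x ∷ xs) ys = begin
  ListAction.sum (map f (map (x ,_) ys ++ cartesianProduct xs ys))
    ≡⟨ cong ListAction.sum (map-++ f (map (x ,_) ys) _) ⟩
  ListAction.sum (map f (map (x ,_) ys) ++ map f (cartesianProduct xs ys))
    ≡⟨ ListAction.sum-++ (map f (map (x ,_) ys)) _ ⟩
  ListAction.sum (map f (map (x ,_) ys)) + ListAction.sum (map f (cartesianProduct xs ys))
    ≡⟨ cong₂ _+_ (cong ListAction.sum (sym (map-∘ ys))) (sum-cartesianProduct f xs ys) ⟩
  _ ∎
  where open ≡-Reasoning

sum-tabulate : ∀ {n} (f : Fin n → ℕ) → ListAction.sum (List.tabulate f) ≡ sum f
sum-tabulate {zero}  f = refl
sum-tabulate {suc n} f = cong (f zero +_) (sum-tabulate (f ∘ suc))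

sum-allFin : ∀ {n} (f : Fin n → ℕ) → ListAction.sum (map f (allFin n)) ≡ sum f
sum-allFin f = trans (cong ListAction.sum (map-tabulate id f)) (sum-tabulate f)

module _ {N : ℕ} where

  span : Graph N → Subset N → ℕ
  span G S = length (spanned G S)

  inside₂ : Graph N → Subset N → Fin N → Fin N → Bool
  inside₂ G S x y = adj G x y ∧ (lookup S x ∧ lookup S y)

  span-∑∑ : ∀ (G : Graph N) S → span G S ≡ ∑∑ (λ x y → ⟦ does (x <? y) ∧ inside₂ G S x y ⟧)
  span-∑∑ G S = begin
    span G S
      ≡⟨ length-filter² E? S? (cartesianProduct (allFin N) (allFin N)) ⟩
    ListAction.sum (map f (cartesianProduct (allFin N) (allFin N)))
      ≡⟨ sum-cartesianProduct f (allFin N) (allFin N) ⟩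
    ListAction.sum (map (λ x → ListAction.sum (map (λ y → f (x , y)) (allFin N))) (allFin N))
      ≡⟨ sum-allFin {N} _ ⟩
    ∑[ x < N ] ListAction.sum (map (λ y → f (x , y)) (allFin N))
      ≡⟨ sum-cong-≗ {N} (λ x → sum-allFin {N} (λ y → f (x , y))) ⟩
    ∑∑ (λ x y → f (x , y))
      ≡⟨ ∑∑-cong {N} (λ x y → cong ⟦_⟧ (trans (∧-assoc (does (x <? y)) (adj G x y) _)
           (cong (λ b → does (x <? y) ∧ (adj G x y ∧ b)) (cong₂ _∧_ (does-∈? x S) (does-∈? y S))))) ⟩
    ∑∑ (λ x y → ⟦ does (x <? y) ∧ inside₂ G S x y ⟧) ∎
    where
    open ≡-Reasoning
    E? = λ ((x , y) : Fin N × Fin N) → (x <? y) ×-dec Adj? G x y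
    S? = λ ((x , y) : Fin N × Fin N) → (x ∈? S) ×-dec (y ∈? S)
    f : Fin N × Fin N → ℕ
    f z = ⟦ does (E? z) ∧ does (S? z) ⟧

  inside₂-sym : ∀ (G : Graph N) S x y → inside₂ G S x y ≡ inside₂ G S y x
  inside₂-sym G S x y = cong₂ _∧_ (adj-sym G x y) (∧-comm (lookup S x) (lookup S y))

  -- Each edge counts once per orientation; this makes the counts below symmetric double sums.
  2*span : ∀ (G : Graph N) S → 2 * span G S ≡ ∑∑ (λ x y → ⟦ inside₂ G S x y ⟧)
  2*span G S = begin
    span G S + (span G S + 0)
      ≡⟨ cong₂ _+_ (span-∑∑ G S) (trans (+-identityʳ _) (trans (span-∑∑ G S) (∑-comm {N} {N} _))) ⟩
    ∑∑ (λ x y → ⟦ does (x <? y) ∧ inside₂ G S x y ⟧) + ∑∑ (λ x y → ⟦ does (y <? x) ∧ inside₂ G S y x ⟧)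
      ≡⟨ ∑∑-distrib-+ {N} _ _ ⟨
    ∑∑ (λ x y → ⟦ does (x <? y) ∧ inside₂ G S x y ⟧ + ⟦ does (y <? x) ∧ inside₂ G S y x ⟧)
      ≡⟨ ∑∑-cong {N} one-orientation ⟩
    ∑∑ (λ x y → ⟦ inside₂ G S x y ⟧) ∎
    where
    open ≡-Reasoning
    one-orientation : ∀ x y → ⟦ does (x <? y) ∧ inside₂ G S x y ⟧ + ⟦ does (y <? x) ∧ inside₂ G S y x ⟧ ≡ ⟦ inside₂ G S x y ⟧
    one-orientation x y with <-cmp x y
    ... | tri< x<y _ y≮x rewrite dec-true (x <? y) x<y | dec-false (y <? x) y≮x = +-identityʳ _
    ... | tri> x≮y _ y<x rewrite dec-false (x <? y) x≮y | dec-true (y <? x) y<x = cong ⟦_⟧ (inside₂-sym G S y x)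
    ... | tri≈ x≮x refl _ rewrite dec-false (x <? x) x≮x | adj-irrefl G x = refl

  -- Neighbourhoods, vertex sets and the effect of adding one vertex

  nbrs : Graph N → Fin N → Subset N
  nbrs G a = tabulate (adj G a)

  ∈nbrs⁺ : ∀ (G : Graph N) {a x} → Adj G a x → x ∈ nbrs G a
  ∈nbrs⁺ G {a} {x} ax = lookup⇒[]= x _ (trans (lookup∘tabulate (adj G a) x) (Equivalence.to T-≡ ax))

  ∈nbrs⁻ : ∀ (G : Graph N) {a x} → x ∈ nbrs G a → Adj G a x
  ∈nbrs⁻ G {a} {x} x∈ = Equivalence.from T-≡ (trans (sym (lookup∘tabulate (adj G a) x)) ([]=⇒lookup x∈))

  Adj-irrefl : ∀ (G : Graph N) {x} → ¬ Adj G x x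
  Adj-irrefl G {x} xx = subst T (adj-irrefl G x) xx

  Adj⇒≢ : ∀ (G : Graph N) {x y} → Adj G x y → x ≢ y
  Adj⇒≢ G xy refl = Adj-irrefl G xy

  Adj-sym : ∀ (G : Graph N) {x y} → Adj G x y → Adj G y x
  Adj-sym G {x} {y} = subst T (adj-sym G x y)

  ∈V⁺ : ∀ (G : Graph N) {x y} → Adj G x y → x ∈ V G
  ∈V⁺ G {x} {y} xy = lookup⇒[]= x _ (trans (lookup∘tabulate (λ z → does (any? (Adj? G z))) x) (dec-true (any? (Adj? G x)) (y , xy)))

  ∈V⁻ : ∀ (G : Graph N) {x} → x ∈ V G → ∃[ y ] Adj G x y
  ∈V⁻ G {x} x∈ = T-does⁻ (any? (Adj? G x)) (Equivalence.from T-≡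
    (trans (sym (lookup∘tabulate (λ z → does (any? (Adj? G z))) x)) ([]=⇒lookup x∈)))

  nbrs⊆V : ∀ (G : Graph N) a → nbrs G a ⊆ V G
  nbrs⊆V G a x∈ = ∈V⁺ G (Adj-sym G (∈nbrs⁻ G x∈))

  span-all : ∀ (G : Graph N) {S} → V G ⊆ S → span G S ≡ length (E G)
  span-all G {S} V⊆S = cong length (filter-all _ (All.map
    (λ (_ , xy) → V⊆S (∈V⁺ G xy) , V⊆S (∈V⁺ G (Adj-sym G xy)))
    (all-filter _ (cartesianProduct (allFin N) (allFin N)))))

  ∣nbrs∩∣ : ∀ (G : Graph N) a S → ∣ nbrs G a ∩ S ∣ ≡ ∑[ y < N ] ⟦ adj G a y ∧ lookup S y ⟧
  ∣nbrs∩∣ G a S = trans (∣∣-∑ (nbrs G a ∩ S)) (sum-cong-≗ {N} λ y →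
    cong ⟦_⟧ (trans (lookup-∩ (nbrs G a) S y) (cong (_∧ lookup S y) (lookup∘tabulate (adj G a) y))))

  -- In the doubled count the new ordered pairs are those starting at `a` and those ending at `a`;
  -- each family contributes the degree of `a` into `S`. The pair (`a`, `a`) contributes nothing
  -- because there are no loops.
  span-∪⁅⁆ : ∀ (G : Graph N) {S a} → a ∉ S → span G (S ∪ ⁅ a ⁆) ≡ span G S + ∣ nbrs G a ∩ S ∣
  span-∪⁅⁆ G {S} {a} a∉S = ℕ.*-cancelˡ-≡ _ _ 2 (begin
    2 * span G (S ∪ ⁅ a ⁆)
      ≡⟨ 2*span G (S ∪ ⁅ a ⁆) ⟩
    ∑∑ (λ x y → ⟦ inside₂ G (S ∪ ⁅ a ⁆) x y ⟧)
      ≡⟨ ∑∑-cong {N} pointwise ⟩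
    ∑∑ (λ x y → ⟦ inside₂ G S x y ⟧ + (f x y + f y x))
      ≡⟨ trans (∑∑-distrib-+ {N} (λ x y → ⟦ inside₂ G S x y ⟧) _)
               (cong (∑∑ (λ x y → ⟦ inside₂ G S x y ⟧) +_) (∑∑-distrib-+ {N} f (λ x y → f y x))) ⟩
    ∑∑ (λ x y → ⟦ inside₂ G S x y ⟧) + (∑∑ f + ∑∑ (λ x y → f y x))
      ≡⟨ cong₂ _+_ (sym (2*span G S)) (cong₂ _+_ ∑∑f (trans (∑-comm {N} {N} (λ x y → f y x)) ∑∑f)) ⟩
    2 * span G S + (∣ nbrs G a ∩ S ∣ + ∣ nbrs G a ∩ S ∣)
      ≡⟨ double (span G S) ∣ nbrs G a ∩ S ∣ ⟩
    2 * (span G S + ∣ nbrs G a ∩ S ∣) ∎)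
    where
    open ≡-Reasoning
    f : Fin N → Fin N → ℕ
    f x y = ⟦ does (x ≟ a) ∧ (adj G x y ∧ lookup S y) ⟧
    double : ∀ s d → 2 * s + (d + d) ≡ 2 * (s + d)
    double = solve-∀
    ∑∑f : ∑∑ f ≡ ∣ nbrs G a ∩ S ∣
    ∑∑f = trans (∑∑-δˡ a (λ x y → adj G x y ∧ lookup S y)) (sym (∣nbrs∩∣ G a S))
    neither : ∀ g b c → ⟦ g ∧ ((b ∨ false) ∧ (c ∨ false)) ⟧ ≡ ⟦ g ∧ (b ∧ c) ⟧ + 0
    neither = by-table (allBool? λ g → allBool? λ b → allBool? λ c → _ ℕ.≟ _)
    pointwise : ∀ x y → ⟦ inside₂ G (S ∪ ⁅ a ⁆) x y ⟧ ≡ ⟦ inside₂ G S x y ⟧ + (f x y + f y x)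
    pointwise x y rewrite lookup-∪ S ⁅ a ⁆ x | lookup-∪ S ⁅ a ⁆ y | lookup-⁅⁆ a x | lookup-⁅⁆ a y
      with x ≟ a | y ≟ a
    ... | yes refl | yes refl rewrite adj-irrefl G a = refl
    ... | no  _    | no  _    = neither (adj G x y) (lookup S x) (lookup S y)
    ... | yes refl | no  _    rewrite ∉⇒lookup a∉S = lem (adj G a y) (lookup S y)
      where lem : ∀ g b → ⟦ g ∧ (true ∧ (b ∨ false)) ⟧ ≡ ⟦ g ∧ false ⟧ + (⟦ g ∧ b ⟧ + 0)
            lem = by-table (allBool? λ g → allBool? λ b → _ ℕ.≟ _)
    ... | no  _    | yes refl rewrite ∉⇒lookup a∉S | adj-sym G x a = lem (adj G a x) (lookup S x)
      where lem : ∀ g b → ⟦ g ∧ ((b ∨ false) ∧ true) ⟧ ≡ ⟦ g ∧ (b ∧ false) ⟧ + ⟦ g ∧ b ⟧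
            lem = by-table (allBool? λ g → allBool? λ b → _ ℕ.≟ _)

  span-remove : ∀ (G : Graph N) {S a} → a ∈ S → span G S ≡ span G (S - a) + ∣ nbrs G a ∩ (S - a) ∣
  span-remove G {S} {a} a∈S = trans (cong (span G) (sym (p-x∪⁅x⁆ a∈S))) (span-∪⁅⁆ G (x∉p-x S a))

  ∈inside₂⁻ : ∀ (G : Graph N) S {x y} → T (inside₂ G S x y) → Adj G x y × x ∈ S × y ∈ S
  ∈inside₂⁻ G S {x} {y} t =
    let xy , s = Equivalence.to (T-∧ {adj G x y}) t
        xS , yS = Equivalence.to (T-∧ {lookup S x}) s
    in xy , lookup⇒[]= x S (Equivalence.to T-≡ xS) , lookup⇒[]= y S (Equivalence.to T-≡ yS)

  ∈inside₂⁺ : ∀ (G : Graph N) S {x y} → Adj G x y → x ∈ S → y ∈ S → T (inside₂ G S x y)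
  ∈inside₂⁺ G S {x} {y} xy x∈S y∈S rewrite []=⇒lookup x∈S | []=⇒lookup y∈S | Equivalence.to T-≡ xy = _

  -- Supermodularity and disjointness of spanned edge sets

  2*span+span : ∀ (G : Graph N) A B →
    2 * (span G A + span G B) ≡ ∑∑ (λ x y → ⟦ inside₂ G A x y ⟧ + ⟦ inside₂ G B x y ⟧)
  2*span+span G A B = begin
    2 * (span G A + span G B)         ≡⟨ ℕ.*-distribˡ-+ 2 (span G A) (span G B) ⟩
    2 * span G A + 2 * span G B       ≡⟨ cong₂ _+_ (2*span G A) (2*span G B) ⟩
    _                                 ≡⟨ ∑∑-distrib-+ {N} (λ x y → ⟦ inside₂ G A x y ⟧) (λ x y → ⟦ inside₂ G B x y ⟧) ⟨
    _                                 ∎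
    where open ≡-Reasoning

  -- A pair inside `A` or inside `B` is inside the union, and a pair inside both is also inside the
  -- intersection. Summing this over all pairs gives supermodularity of `span`.
  inside₂-supermodular : ∀ (G : Graph N) A B x y →
    ⟦ inside₂ G A x y ⟧ + ⟦ inside₂ G B x y ⟧ ≤ ⟦ inside₂ G (A ∪ B) x y ⟧ + ⟦ inside₂ G (A ∩ B) x y ⟧
  inside₂-supermodular G A B x y rewrite lookup-∪ A B x | lookup-∪ A B y | lookup-∩ A B x | lookup-∩ A B y =
    table (adj G x y) (lookup A x) (lookup A y) (lookup B x) (lookup B y)
    where
    table : ∀ g a a′ b b′ → ⟦ g ∧ (a ∧ a′) ⟧ + ⟦ g ∧ (b ∧ b′) ⟧ ≤
            ⟦ g ∧ ((a ∨ b) ∧ (a′ ∨ b′)) ⟧ + ⟦ g ∧ ((a ∧ b) ∧ (a′ ∧ b′)) ⟧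
    table = by-table (allBool? λ _ → allBool? λ _ → allBool? λ _ → allBool? λ _ → allBool? λ _ → _ ≤? _)

  span-supermodular : ∀ (G : Graph N) A B → span G A + span G B ≤ span G (A ∪ B) + span G (A ∩ B)
  span-supermodular G A B = *-cancelˡ-≤ 2 (begin
    2 * (span G A + span G B)               ≡⟨ 2*span+span G A B ⟩
    _                                       ≤⟨ ∑∑-mono-≤ {N} (inside₂-supermodular G A B) ⟩
    _                                       ≡⟨ 2*span+span G (A ∪ B) (A ∩ B) ⟨
    2 * (span G (A ∪ B) + span G (A ∩ B))   ∎)
    where open ≤-Reasoning

  -- The crossing edge is counted in the union but in neither set, so at the ordered pair (`p`, `q`)
  -- the left side is 0 and the right side is positive. One such pair already makes the doubled
  -- inequality strict, and strictness survives halving.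
  span-supermodular-< : ∀ (G : Graph N) A B {p q} → Adj G p q → p ∈ A ∪ B → q ∈ A ∪ B →
    ¬ (p ∈ A × q ∈ A) → ¬ (p ∈ B × q ∈ B) →
    span G A + span G B < span G (A ∪ B) + span G (A ∩ B)
  span-supermodular-< G A B {p} {q} pq p∈ q∈ ∉A ∉B = ℕ.*-cancelˡ-< 2 _ _ (begin
    suc (2 * (span G A + span G B))         ≡⟨ cong₂ _+_ (sym ∑∑δ≡1) (2*span+span G A B) ⟩
    ∑∑ δ + ∑∑ f                             ≡⟨ ∑∑-distrib-+ δ f ⟨
    ∑∑ (λ x y → δ x y + f x y)              ≤⟨ ∑∑-mono-≤ {N} pointwise ⟩
    ∑∑ g                                    ≡⟨ 2*span+span G (A ∪ B) (A ∩ B) ⟨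
    2 * (span G (A ∪ B) + span G (A ∩ B))   ∎)
    where
    open ≤-Reasoning
    δ f g : Fin N → Fin N → ℕ
    -- The indicator of the single ordered pair (`p`, `q`); the factor `true` gives it the shape
    -- that `∑-δ` expects.
    δ x y = ⟦ does (x ≟ p) ∧ (does (y ≟ q) ∧ true) ⟧
    f x y = ⟦ inside₂ G A x y ⟧ + ⟦ inside₂ G B x y ⟧
    g x y = ⟦ inside₂ G (A ∪ B) x y ⟧ + ⟦ inside₂ G (A ∩ B) x y ⟧
    ∑∑δ≡1 : ∑∑ δ ≡ 1
    ∑∑δ≡1 = trans (∑∑-δˡ p (λ x y → does (y ≟ q) ∧ true)) (∑-δ q (λ _ → true))
    not-inside : ∀ S → ¬ (p ∈ S × q ∈ S) → inside₂ G S p q ≡ false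
    not-inside S ∉S with inside₂ G S p q in eq
    ... | false = refl
    ... | true  = contradiction (proj₂ (∈inside₂⁻ G S (subst T (sym eq) _))) ∉S
    pointwise : ∀ x y → δ x y + f x y ≤ g x y
    pointwise x y with x ≟ p | y ≟ q
    ... | yes refl | yes refl
      rewrite not-inside A ∉A | not-inside B ∉B | Equivalence.to T-≡ (∈inside₂⁺ G (A ∪ B) pq p∈ q∈) = s≤s z≤n
    ... | yes refl | no _ = inside₂-supermodular G A B x y
    ... | no _     | _    = inside₂-supermodular G A B x y

  ⟦⟧-disjoint : ∀ a b c u → (T a → T u) → (T b → T u) → (T c → T u) →
    ¬ (T a × T b) → ¬ (T a × T c) → ¬ (T b × T c) → (⟦ a ⟧ + ⟦ b ⟧) + ⟦ c ⟧ ≤ ⟦ u ⟧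
  ⟦⟧-disjoint true  true  _     _     _ _ _ ab _ _ = contradiction _ ab
  ⟦⟧-disjoint true  false true  _     _ _ _ _ ac _ = contradiction _ ac
  ⟦⟧-disjoint false true  true  _     _ _ _ _ _ bc = contradiction _ bc
  ⟦⟧-disjoint true  false false true  _ _ _ _ _ _ = ≤-refl
  ⟦⟧-disjoint true  false false false a _ _ _ _ _ = ⊥-elim (a _)
  ⟦⟧-disjoint false true  false true  _ _ _ _ _ _ = ≤-refl
  ⟦⟧-disjoint false true  false false _ b _ _ _ _ = ⊥-elim (b _)
  ⟦⟧-disjoint false false true  true  _ _ _ _ _ _ = ≤-refl
  ⟦⟧-disjoint false false true  false _ _ c _ _ _ = ⊥-elim (c _)
  ⟦⟧-disjoint false false false _     _ _ _ _ _ _ = z≤n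

  -- An edge has two distinct ends, so it cannot lie inside two sets that share fewer than two
  -- vertices; no edge is counted twice on the left.
  span-∪-disjoint : ∀ (G : Graph N) A B C → ∣ A ∩ B ∣ < 2 → ∣ A ∩ C ∣ < 2 → ∣ B ∩ C ∣ < 2 →
    (span G A + span G B) + span G C ≤ span G ((A ∪ B) ∪ C)
  span-∪-disjoint G A B C AB AC BC = *-cancelˡ-≤ 2 (begin
    2 * ((span G A + span G B) + span G C)          ≡⟨ ℕ.*-distribˡ-+ 2 (span G A + span G B) _ ⟩
    2 * (span G A + span G B) + 2 * span G C        ≡⟨ cong₂ _+_ (2*span+span G A B) (2*span G C) ⟩
    _
      ≡⟨ ∑∑-distrib-+ {N} (λ x y → ⟦ inside₂ G A x y ⟧ + ⟦ inside₂ G B x y ⟧) (λ x y → ⟦ inside₂ G C x y ⟧) ⟨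
    _                                               ≤⟨ ∑∑-mono-≤ {N} pointwise ⟩
    _                                               ≡⟨ 2*span G ((A ∪ B) ∪ C) ⟨
    2 * span G ((A ∪ B) ∪ C)                        ∎)
    where
    open ≤-Reasoning
    U = (A ∪ B) ∪ C
    mono : ∀ {S x y} → S ⊆ U → T (inside₂ G S x y) → T (inside₂ G U x y)
    mono {S} S⊆U t = let xy , x∈ , y∈ = ∈inside₂⁻ G S t in ∈inside₂⁺ G U xy (S⊆U x∈) (S⊆U y∈)
    apart : ∀ {S S′ x y} → ∣ S ∩ S′ ∣ < 2 → ¬ (T (inside₂ G S x y) × T (inside₂ G S′ x y))
    apart {S} {S′} small (t , t′) =
      let xy , x∈S , y∈S = ∈inside₂⁻ G S t ; _ , x∈S′ , y∈S′ = ∈inside₂⁻ G S′ t′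
      in ℕ.<⇒≱ small (2≤∣p∣ (x∈p∩q⁺ (x∈S , x∈S′)) (x∈p∩q⁺ (y∈S , y∈S′)) (Adj⇒≢ G xy))
    pointwise : ∀ x y → (⟦ inside₂ G A x y ⟧ + ⟦ inside₂ G B x y ⟧) + ⟦ inside₂ G C x y ⟧ ≤ ⟦ inside₂ G U x y ⟧
    pointwise x y = ⟦⟧-disjoint _ _ _ _
      (mono {A} λ z → x∈p∪q⁺ (inj₁ (x∈p∪q⁺ (inj₁ z)))) (mono {B} λ z → x∈p∪q⁺ (inj₁ (x∈p∪q⁺ (inj₂ z))))
      (mono {C} λ z → x∈p∪q⁺ (inj₂ z)) (apart {A} {B} AB) (apart {A} {C} AC) (apart {B} {C} BC)

  span-small : ∀ (G : Graph N) {S} → ∣ S ∣ < 2 → span G S ≡ 0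
  span-small G {S} small = cong length (filter-none _ (All.map
    (λ (_ , xy) (x∈S , y∈S) → ℕ.<⇒≱ small (2≤∣p∣ x∈S y∈S (Adj⇒≢ G xy)))
    (all-filter _ (cartesianProduct (allFin N) (allFin N)))))

  -- The handshake identity, obtained by reading the degree sum as the doubled count of the edges
  -- inside `V G`.
  ∑-degrees : ∀ (G : Graph N) → ∑[ x < N ] ∣ nbrs G x ∣ ≡ 2 * length (E G)
  ∑-degrees G = begin
    ∑[ x < N ] ∣ nbrs G x ∣               ≡⟨ sum-cong-≗ {N} (λ x → ∣∣-∑ (nbrs G x)) ⟩
    ∑∑ (λ x y → ⟦ lookup (nbrs G x) y ⟧)  ≡⟨ ∑∑-cong {N} (λ x y → cong ⟦_⟧ (trans (lookup∘tabulate (adj G x) y) (in-V x y))) ⟩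
    ∑∑ (λ x y → ⟦ inside₂ G (V G) x y ⟧)  ≡⟨ 2*span G (V G) ⟨
    2 * span G (V G)                      ≡⟨ cong (2 *_) (span-all G {V G} id) ⟩
    2 * length (E G)                      ∎
    where
    open ≡-Reasoning
    in-V : ∀ x y → adj G x y ≡ inside₂ G (V G) x y
    in-V x y with adj G x y in eq
    ... | false = refl
    ... | true rewrite []=⇒lookup (∈V⁺ G {x} {y} (subst T (sym eq) _))
                     | []=⇒lookup (∈V⁺ G {y} {x} (Adj-sym G (subst T (sym eq) _))) = refl

-- Vertex degrees in a rigidity circuit

module Circuit {N : ℕ} (C : Graph N) (circuit : IsRigidityCircuit C) where
  open IsRigidityCircuit circuit

  span-V : span C (V C) + 2 ≡ 2 * ∣ V C ∣
  span-V = trans (cong (_+ 2) (span-all C {V C} id)) edge-count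

  2≤∣V∣ : 2 ≤ ∣ V C ∣
  2≤∣V∣ with nonempty? (V C)
  ... | yes (x , x∈V) = let y , xy = ∈V⁻ C x∈V in
        2≤∣p∣ x∈V (∈V⁺ C (Adj-sym C xy)) (Adj⇒≢ C xy)
  ... | no empty = contradiction (trans span-V (cong (2 *_) (trans (cong ∣_∣ (Empty-unique empty)) (∣⊥∣≡0 N)))) (ℕ.m+1+n≢0 _)

  -- Two vertices would have to carry two edges, but a simple graph has at most one there. The bound
  -- makes the sparsity condition applicable to `V C - v`.
  3≤∣V∣ : 3 ≤ ∣ V C ∣
  3≤∣V∣ with ∣ V C ∣ ℕ.≟ 2
  ... | no  ≢2 = ℕ.≤∧≢⇒< 2≤∣V∣ (≢2 ∘ sym)
  ... | yes ≡2 = let x , x∈V , _ = pick (V C) 2≤∣V∣ in ⊥-elim (absurd x∈V)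
    where
    absurd : ∀ {x} → ¬ (x ∈ V C)
    absurd {x} x∈V = ℕ.<⇒≱ ≤-refl 4≤3
      where
      open ≤-Reasoning
      ≡1 : ∣ V C - x ∣ ≡ 1
      ≡1 = ℕ.suc-injective (trans (sym (∣p∣≡1+∣p-x∣ x∈V)) ≡2)
      4≤3 : 4 ≤ 3
      4≤3 = begin
        4                                                      ≡⟨ cong (2 *_) ≡2 ⟨
        2 * ∣ V C ∣                                            ≡⟨ span-V ⟨
        span C (V C) + 2                                       ≡⟨ cong (_+ 2) (span-remove C x∈V) ⟩
        (span C (V C - x) + ∣ nbrs C x ∩ (V C - x) ∣) + 2
          ≡⟨ cong (λ s → (s + ∣ nbrs C x ∩ (V C - x) ∣) + 2) (span-small C (≤-reflexive (cong suc ≡1))) ⟩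
        ∣ nbrs C x ∩ (V C - x) ∣ + 2                           ≤⟨ ℕ.+-monoˡ-≤ 2 (∣p∩q∣≤∣q∣ (nbrs C x) (V C - x)) ⟩
        ∣ V C - x ∣ + 2                                        ≡⟨ cong (_+ 2) ≡1 ⟩
        3                                                      ∎

  module _ {v} (v∈V : v ∈ V C) where

    private
      m = ∣ V C - v ∣
      s = span C (V C - v)
      d = ∣ nbrs C v ∩ (V C - v) ∣
      count : 2 * suc m ≡ (s + d) + 2
      count = trans (cong (2 *_) (sym (∣p∣≡1+∣p-x∣ v∈V))) (trans (sym span-V) (cong (_+ 2) (span-remove C v∈V)))
      d≤ : d ≤ ∣ nbrs C v ∣
      d≤ = ∣p∩q∣≤∣p∣ (nbrs C v) (V C - v)

    -- `V C` spans 2n - 2 edges while `V C - v` spans at most 2(n - 1) - 3, so at least three edges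
    -- disappear with `v`.
    degree≥3 : 3 ≤ ∣ nbrs C v ∣
    degree≥3 = ≤-trans (cancel-common (s + 2 + 2 * m)
      (+-mono-≤ (≤-reflexive count) (sparse (V C - v) (x∈p⇒p-x⊂p v∈V) (ℕ.≤-pred (subst (3 ≤_) (∣p∣≡1+∣p-x∣ v∈V) 3≤∣V∣))))
      (eq₁ s m) (eq₂ s m d)) d≤
      where
      eq₁ : ∀ s m → 2 * suc m + (s + 3) ≡ 3 + (s + 2 + 2 * m)
      eq₁ = solve-∀
      eq₂ : ∀ s m d → ((s + d) + 2) + 2 * m ≡ d + (s + 2 + 2 * m)
      eq₂ = solve-∀

    -- Losing at most three of the 2n - 2 edges leaves at least 2(n - 1) - 3.
    remove-tight : ∣ nbrs C v ∣ ≡ 3 → 2 * m ≤ s + 3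
    remove-tight deg = cancel-common (2 + d)
      (+-mono-≤ (≤-reflexive count) (≤-trans d≤ (≤-reflexive deg)))
      (eq₁ m d) (eq₂ s d)
      where
      eq₁ : ∀ m d → 2 * suc m + d ≡ 2 * m + (2 + d)
      eq₁ = solve-∀
      eq₂ : ∀ s d → ((s + d) + 2) + 3 ≡ (s + 3) + (2 + d)
      eq₂ = solve-∀

  cubic : Subset N
  cubic = tabulate (λ x → does (∣ nbrs C x ∣ ℕ.≟ 3))

  ∈cubic⁻ : ∀ {x} → x ∈ cubic → ∣ nbrs C x ∣ ≡ 3
  ∈cubic⁻ {x} x∈ = T-does⁻ (∣ nbrs C x ∣ ℕ.≟ 3) (Equivalence.from T-≡
    (trans (sym (lookup∘tabulate (λ z → does (∣ nbrs C z ∣ ℕ.≟ 3)) x)) ([]=⇒lookup x∈)))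

  cubic⊆V : cubic ⊆ V C
  cubic⊆V x∈ = let y , y∈ , _ = pick {k = 2} (nbrs C _) (≤-reflexive (sym (∈cubic⁻ x∈))) in ∈V⁺ C (∈nbrs⁻ C y∈)

  -- Every vertex satisfies 4 ≤ degree + [degree = 3]. Summing over `V C` gives 4n ≤ 2|E| +
  -- |`cubic`|, and 2|E| = 4n - 4.
  4≤∣cubic∣ : 4 ≤ ∣ cubic ∣
  4≤∣cubic∣ = cancel-common (2 * length (E C) + 4 * ∣ V C ∣)
    (+-mono-≤ weights (≤-reflexive (cong (2 *_) edge-count)))
    (eq₁ (length (E C)) ∣ V C ∣) (eq₂ (length (E C)) (∣ V C ∣) (∣ cubic ∣))
    where
    -- The indicator of `V C`; fourfold sums of it are written as repeated addition so that they
    -- split by `∑-distrib-+`.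
    c : Fin N → ℕ
    c x = ⟦ lookup (V C) x ⟧
    ∑c : sum c ≡ ∣ V C ∣
    ∑c = sym (∣∣-∑ (V C))
    4c : ∑[ x < N ] ((c x + c x) + (c x + c x)) ≡ (∣ V C ∣ + ∣ V C ∣) + (∣ V C ∣ + ∣ V C ∣)
    4c = trans (∑-distrib-+ (λ x → c x + c x) (λ x → c x + c x)) (cong₂ _+_ 2c 2c)
      where
      2c : ∑[ x < N ] (c x + c x) ≡ ∣ V C ∣ + ∣ V C ∣
      2c = trans (∑-distrib-+ c c) (cong₂ _+_ ∑c ∑c)
    weight : ∀ {d} → 3 ≤ d → 4 ≤ d + ⟦ does (d ℕ.≟ 3) ⟧
    weight {d} 3≤d with d ℕ.≟ 3
    ... | yes refl = ≤-refl
    ... | no  ≢3   = ≤-trans (ℕ.≤∧≢⇒< 3≤d (≢3 ∘ sym)) (ℕ.m≤m+n _ _)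
    pointwise : ∀ x → (c x + c x) + (c x + c x) ≤ ∣ nbrs C x ∣ + ⟦ lookup cubic x ⟧
    pointwise x with x ∈? V C
    ... | no x∉V rewrite ∉⇒lookup x∉V = z≤n
    ... | yes x∈V rewrite []=⇒lookup x∈V | lookup∘tabulate (λ z → does (∣ nbrs C z ∣ ℕ.≟ 3)) x =
      weight (degree≥3 x∈V)
    weights : (∣ V C ∣ + ∣ V C ∣) + (∣ V C ∣ + ∣ V C ∣) ≤ 2 * length (E C) + ∣ cubic ∣
    weights = begin
      _                                                      ≡⟨ 4c ⟨
      ∑[ x < N ] ((c x + c x) + (c x + c x))                 ≤⟨ ∑-mono-≤ {N} pointwise ⟩
      ∑[ x < N ] (∣ nbrs C x ∣ + ⟦ lookup cubic x ⟧)         ≡⟨ ∑-distrib-+ (λ x → ∣ nbrs C x ∣) (λ x → ⟦ lookup cubic x ⟧) ⟩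
      _                                                      ≡⟨ cong₂ _+_ (∑-degrees C) (sym (∣∣-∑ cubic)) ⟩
      2 * length (E C) + ∣ cubic ∣                           ∎
      where open ≤-Reasoning
    eq₁ : ∀ e n → ((n + n) + (n + n)) + 2 * (e + 2) ≡ 4 + (2 * e + 4 * n)
    eq₁ = solve-∀
    eq₂ : ∀ e n q → (2 * e + q) + 2 * (2 * n) ≡ q + (2 * e + 4 * n)
    eq₂ = solve-∀

  -- Tight sets

  -- Only the lower bound on the edge count is stated; for proper subsets of `V C` with at least two
  -- vertices, sparsity supplies the other inequality.
  Tight : Subset N → Set
  Tight S = 2 * ∣ S ∣ ≤ span C S + 3

  -- The intersection is a proper subset with at least two vertices, so it spans at most 2|`A ∩ B`|
  -- - 3 edges; supermodularity then pushes the remaining edges into the union.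
  tight-∪ : ∀ {A B} → A ⊂ V C → Tight A → Tight B → 2 ≤ ∣ A ∩ B ∣ → Tight (A ∪ B)
  tight-∪ {A} {B} A⊂V tA tB 2≤ = cancel-common
    (2 * ∣ A ∣ + 2 * ∣ B ∣ + (span C (A ∩ B) + 3) + (span C A + span C B) + 2 * ∣ A ∩ B ∣)
    (+-mono-≤ (+-mono-≤ (+-mono-≤ tA tB) (+-mono-≤ (sparse (A ∩ B) (⊆-⊂-trans (p∩q⊆p A B) A⊂V) 2≤) (span-supermodular C A B)))
              (≤-reflexive (cong (2 *_) (∣∪∣+∣∩∣ A B))))
    (eq₁ (∣ A ∣) (∣ B ∣) (∣ A ∪ B ∣) (∣ A ∩ B ∣) (span C A) (span C B) (span C (A ∪ B)) (span C (A ∩ B)))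
    (eq₂ (∣ A ∣) (∣ B ∣) (∣ A ∪ B ∣) (∣ A ∩ B ∣) (span C A) (span C B) (span C (A ∪ B)) (span C (A ∩ B)))
    where
    eq₁ : ∀ a b u i sa sb su si → ((2 * a + 2 * b) + ((si + 3) + (sa + sb))) + 2 * (u + i) ≡
          2 * u + (2 * a + 2 * b + (si + 3) + (sa + sb) + 2 * i)
    eq₁ = solve-∀
    eq₂ : ∀ a b u i sa sb su si → (((sa + 3) + (sb + 3)) + (2 * i + (su + si))) + 2 * (a + b) ≡
          (su + 3) + (2 * a + 2 * b + (si + 3) + (sa + sb) + 2 * i)
    eq₂ = solve-∀

  -- Cliques of degree-three vertices

  Clique : Subset N → Set
  Clique S = ∀ {x y} → x ∈ S → y ∈ S → x ≢ y → Adj C x y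

  clique-nbrs : ∀ {S a} → Clique S → a ∈ S → S - a ⊆ nbrs C a
  clique-nbrs {S} {a} clique a∈S x∈ = let x∈S , x≢a = x∈p-y⁻ S a x∈ in ∈nbrs⁺ C (clique a∈S x∈S (x≢a ∘ sym))

  -- The binomial coefficient k(k - 1)/2, the number of edges of a complete graph on k vertices.
  triangular : ℕ → ℕ
  triangular zero    = 0
  triangular (suc k) = triangular k + k

  clique-span : ∀ k {S} → ∣ S ∣ ≡ k → Clique S → triangular k ≤ span C S
  clique-span zero    _    _      = z≤n
  clique-span (suc k) {S} ∣S∣ clique =
    let a , a∈S , _ = pick {k = k} S (≤-reflexive (sym ∣S∣))
        ∣S-a∣ = ℕ.suc-injective (trans (sym (∣p∣≡1+∣p-x∣ a∈S)) ∣S∣)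
    in begin
      triangular k + k
        ≤⟨ +-mono-≤ (clique-span k ∣S-a∣ λ x∈ y∈ → clique (proj₁ (x∈p-y⁻ S a x∈)) (proj₁ (x∈p-y⁻ S a y∈)))
                    (≤-reflexive (sym ∣S-a∣)) ⟩
      span C (S - a) + ∣ S - a ∣
        ≤⟨ ℕ.+-monoʳ-≤ (span C (S - a)) (p⊆q⇒∣p∣≤∣q∣ λ x∈ → x∈p∩q⁺ (clique-nbrs clique a∈S x∈ , x∈)) ⟩
      span C (S - a) + ∣ nbrs C a ∩ (S - a) ∣      ≡⟨ span-remove C a∈S ⟨
      span C S                                     ∎
    where open ≤-Reasoning

  -- Equality holds at k = 4, and from there each step adds 2 on the left and k ≥ 4 on the right.
  triangular-≥ : ∀ {k} → 4 ≤ k → 2 * k ≤ triangular k + 2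
  triangular-≥ {k} 4≤k = subst (λ k → 2 * k ≤ triangular k + 2) (ℕ.m∸n+n≡m 4≤k) (from-4 (k ∸ 4))
    where
    from-4 : ∀ j → 2 * (j + 4) ≤ triangular (j + 4) + 2
    from-4 zero    = ≤-refl
    from-4 (suc j) = begin
      2 * suc (j + 4)                       ≡⟨ ℕ.*-suc 2 (j + 4) ⟩
      2 + 2 * (j + 4)                       ≤⟨ +-mono-≤ (≤-trans (s≤s (s≤s z≤n)) (ℕ.m≤n+m 4 j)) (from-4 j) ⟩
      (j + 4) + (triangular (j + 4) + 2)    ≡⟨ regroup (j + 4) (triangular (j + 4)) ⟩
      (triangular (j + 4) + (j + 4)) + 2    ∎
      where
      open ≤-Reasoning
      regroup : ∀ a b → a + (b + 2) ≡ (b + a) + 2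
      regroup = solve-∀

  -- A clique on k ≥ 4 vertices spans at least 2k - 2 edges, too many for a proper subset, so the
  -- cubic vertices are all of `V C`. A vertex of degree 3 adjacent to all the others then bounds
  -- the order by 4.
  clique⇒K₄ : Clique cubic → IsK₄ C
  clique⇒K₄ clique = record
    { order    = ℕ.≤-antisym ∣V∣≤4 (subst (λ S → 4 ≤ ∣ S ∣) cubic≡V 4≤∣cubic∣)
    ; complete = λ x y x∈ y∈ → clique (V⊆ x∈) (V⊆ y∈)
    }
    where
    cubic≡V : cubic ≡ V C
    cubic≡V = ⊆∧⊄⇒≡ cubic⊆V λ cubic⊂V → ℕ.<⇒≱
      (ℕ.+-monoʳ-< (span C cubic) {2} {3} ≤-refl)
      (≤-trans (sparse cubic cubic⊂V (≤-trans (s≤s (s≤s z≤n)) 4≤∣cubic∣))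
        (≤-trans (triangular-≥ 4≤∣cubic∣) (ℕ.+-monoˡ-≤ 2 (clique-span _ refl clique))))
    V⊆ : V C ⊆ cubic
    V⊆ {x} = subst (x ∈_) (sym cubic≡V)
    ∣V∣≤4 : ∣ V C ∣ ≤ 4
    ∣V∣≤4 = let a , a∈ , _ = pick {k = 3} cubic 4≤∣cubic∣ in
      subst (λ S → ∣ S ∣ ≤ 4) cubic≡V (≤-trans (≤-reflexive (∣p∣≡1+∣p-x∣ a∈))
        (s≤s (≤-trans (p⊆q⇒∣p∣≤∣q∣ (clique-nbrs clique a∈)) (≤-reflexive (∈cubic⁻ a∈)))))

  K₄-or-independent-cubic : IsK₄ C ⊎ (∃[ v ] ∃[ w ] v ∈ cubic × w ∈ cubic × v ≢ w × ¬ Adj C v w)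
  K₄-or-independent-cubic
    with any? (λ v → any? (λ w → (v ∈? cubic) ×-dec (w ∈? cubic) ×-dec ¬? (v ≟ w) ×-dec ¬? (Adj? C v w)))
  ... | yes pair = inj₂ pair
  ... | no none  = inj₁ (clique⇒K₄ λ {x} {y} x∈ y∈ x≢y →
        decidable-stable (Adj? C x y) λ ¬xy → none (x , y , x∈ , y∈ , x≢y , ¬xy))

  -- If two of the sets share two vertices their union is tight;
  -- otherwise the three spanned edge sets are disjoint and the vertex counts overlap in exactly a, b, c.
  tight-triangle : ∀ {W A B D a b c} → W ⊂ V C → A ⊆ W → B ⊆ W → D ⊆ W → Tight A → Tight B → Tight D →
    a ∈ A → b ∈ A → a ∈ B → c ∈ B → b ∈ D → c ∈ D → b ≢ c →
    ∃[ U ] U ⊆ W × Tight U × a ∈ U × b ∈ U × c ∈ U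
  tight-triangle {W} {A} {B} {D} {a} {b} {c} W⊂V A⊆W B⊆W D⊆W tA tB tD a∈A b∈A a∈B c∈B b∈D c∈D b≢c
    with 2 ≤? ∣ A ∩ B ∣ | 2 ≤? ∣ A ∩ D ∣ | 2 ≤? ∣ B ∩ D ∣
  ... | yes AB | _ | _ = A ∪ B , ∪-⊆ A⊆W B⊆W , tight-∪ (⊆-⊂-trans A⊆W W⊂V) tA tB AB ,
        x∈p∪q⁺ (inj₁ a∈A) , x∈p∪q⁺ (inj₁ b∈A) , x∈p∪q⁺ (inj₂ c∈B)
  ... | no _ | yes AD | _ = A ∪ D , ∪-⊆ A⊆W D⊆W , tight-∪ (⊆-⊂-trans A⊆W W⊂V) tA tD AD ,
        x∈p∪q⁺ (inj₁ a∈A) , x∈p∪q⁺ (inj₁ b∈A) , x∈p∪q⁺ (inj₂ c∈D)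
  ... | no _ | no _ | yes BD = B ∪ D , ∪-⊆ B⊆W D⊆W , tight-∪ (⊆-⊂-trans B⊆W W⊂V) tB tD BD ,
        x∈p∪q⁺ (inj₁ a∈B) , x∈p∪q⁺ (inj₂ b∈D) , x∈p∪q⁺ (inj₁ c∈B)
  ... | no AB | no AD | no BD = (A ∪ B) ∪ D , ∪-⊆ (∪-⊆ A⊆W B⊆W) D⊆W , tight ,
        x∈p∪q⁺ (inj₁ (x∈p∪q⁺ (inj₁ a∈A))) , x∈p∪q⁺ (inj₁ (x∈p∪q⁺ (inj₁ b∈A))) , x∈p∪q⁺ (inj₂ c∈D)
    where
    1≤A∩B : 1 ≤ ∣ A ∩ B ∣
    1≤A∩B = subst (_≤ ∣ A ∩ B ∣) (∣⁅x⁆∣≡1 a) (p⊆q⇒∣p∣≤∣q∣ λ x∈a →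
      subst (_∈ A ∩ B) (sym (x∈⁅y⁆⇒x≡y a x∈a)) (x∈p∩q⁺ (a∈A , a∈B)))
    2≤[A∪B]∩D : 2 ≤ ∣ (A ∪ B) ∩ D ∣
    2≤[A∪B]∩D = 2≤∣p∣ (x∈p∩q⁺ (x∈p∪q⁺ (inj₁ b∈A) , b∈D)) (x∈p∩q⁺ (x∈p∪q⁺ (inj₂ c∈B) , c∈D)) b≢c
    glue : ∀ k {a b m i p q} → 2 * a ≤ p → 2 * b ≤ q → m + i ≡ a + b → k ≤ i → 2 * m + 2 * k ≤ p + q
    glue k {a} {b} {m} {i} {p} {q} 2a≤p 2b≤q m+i≡a+b k≤i = begin
      2 * m + 2 * k  ≤⟨ ℕ.+-monoʳ-≤ (2 * m) (ℕ.*-monoʳ-≤ 2 k≤i) ⟩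
      2 * m + 2 * i  ≡⟨ ℕ.*-distribˡ-+ 2 m i ⟨
      2 * (m + i)    ≡⟨ cong (2 *_) m+i≡a+b ⟩
      2 * (a + b)    ≡⟨ ℕ.*-distribˡ-+ 2 a b ⟩
      2 * a + 2 * b  ≤⟨ +-mono-≤ 2a≤p 2b≤q ⟩
      p + q          ∎
      where open ≤-Reasoning
    -- The constants record the defects: sharing `a` gives 3 + 3 - 2 = 4 for `A ∪ B`, and sharing
    -- `b` and `c` with `D` then gives 4 + 3 - 4 = 3, which is tightness.
    2∣A∪B∣ : 2 * ∣ A ∪ B ∣ ≤ (span C A + span C B) + 4
    2∣A∪B∣ = +-cancelʳ-≤ 2 _ _ (≤-trans
      (glue 1 {∣ A ∣} {∣ B ∣} {∣ A ∪ B ∣} {∣ A ∩ B ∣} tA tB (∣∪∣+∣∩∣ A B) 1≤A∩B)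
      (≤-reflexive (eq (span C A) (span C B))))
      where
      eq : ∀ s t → (s + 3) + (t + 3) ≡ ((s + t) + 4) + 2
      eq = solve-∀
    tight : Tight ((A ∪ B) ∪ D)
    tight = ≤-trans (+-cancelʳ-≤ 4 _ _ (≤-trans
      (glue 2 {∣ A ∪ B ∣} {∣ D ∣} {∣ (A ∪ B) ∪ D ∣} {∣ (A ∪ B) ∩ D ∣} 2∣A∪B∣ tD (∣∪∣+∣∩∣ (A ∪ B) D) 2≤[A∪B]∩D)
      (≤-reflexive (eq (span C A + span C B) (span C D)))))
      (ℕ.+-monoˡ-≤ 3 (span-∪-disjoint C A B D (ℕ.≰⇒> AB) (ℕ.≰⇒> AD) (ℕ.≰⇒> BD)))
      where
      eq : ∀ s t → (s + 4) + (t + 3) ≡ ((s + t) + 3) + 4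
      eq = solve-∀

  -- Neighbours of a vertex that no tight set joins

  Joined : Subset N → Fin N → Fin N → Subset N → Set
  Joined W x y Z = Z ⊆ W × x ∈ Z × y ∈ Z × Tight Z

  joined? : ∀ W x y → Dec (∃[ Z ] Joined W x y Z)
  joined? W x y = anySubset? λ Z → (Z ⊆? W) ×-dec (x ∈? Z) ×-dec (y ∈? Z) ×-dec (2 * ∣ Z ∣ ≤? span C Z + 3)

  -- If every pair among three neighbours of `v` were joined, `tight-triangle` would give a tight
  -- `U` containing all three, and adding `v` would bring three edges for one vertex. Excluding `w`
  -- from `W` keeps the enlarged set proper, so that this violates sparsity.
  unjoined-nbrs : ∀ {v w} → v ∈ V C → w ∈ V C → v ≢ w → 3 ≤ ∣ nbrs C v ∣ → nbrs C v ⊆ V C - v - w →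
    ∃[ x ] ∃[ y ] x ∈ V C - v - w × y ∈ V C - v - w × x ≢ y × ¬ (∃[ Z ] Joined (V C - v - w) x y Z)
  unjoined-nbrs {v} {w} v∈V w∈V v≢w 3≤deg nbrs⊆W =
    let a , b , c , a∈ , b∈ , c∈ , a≢b , a≢c , b≢c = pick₃ (nbrs C v) 3≤deg
    in among a∈ b∈ c∈ a≢b a≢c b≢c
    where
    W = V C - v - w
    W⊆V-v : W ⊆ V C - v
    W⊆V-v x∈ = proj₁ (x∈p-y⁻ (V C - v) w x∈)
    W⊂V : W ⊂ V C
    W⊂V = (λ x∈ → proj₁ (x∈p-y⁻ (V C) v (W⊆V-v x∈))) , w , w∈V , x∉p-x (V C - v) w
    too-dense : ∀ {a b c} → a ∈ nbrs C v → b ∈ nbrs C v → c ∈ nbrs C v → a ≢ b → a ≢ c → b ≢ c →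
      ∀ {U} → U ⊆ W → Tight U → a ∈ U → b ∈ U → ¬ (c ∈ U)
    -- Sparsity of `U` with `v` added, tightness of `U` and the three edges from `v` into `U` add up
    -- to 6 ≤ 5.
    too-dense a∈ b∈ c∈ a≢b a≢c b≢c {U} U⊆W tU a∈U b∈U c∈U = ℕ.<⇒≱ {5} {6} ≤-refl (cancel-common (span C U + 2 * ∣ U ∣ + ∣ nbrs C v ∩ U ∣)
      (+-mono-≤ (+-mono-≤ sparse′ tU) 3≤d)
      (eq₁ (span C U) (∣ U ∣) (∣ nbrs C v ∩ U ∣)) (eq₂ (span C U) (∣ U ∣) (∣ nbrs C v ∩ U ∣)))
      where
      v∉U : v ∉ U
      v∉U v∈U = x∉p-x (V C) v (W⊆V-v (U⊆W v∈U))
      U+v⊂V : U ∪ ⁅ v ⁆ ⊂ V C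
      U+v⊂V = ∪-⊆ {p = U} (λ x∈ → proj₁ W⊂V (U⊆W x∈)) (λ x∈ → subst (_∈ V C) (sym (x∈⁅y⁆⇒x≡y v x∈)) v∈V) ,
        w , w∈V , λ w∈ → w∉ (x∈p∪q⁻ U ⁅ v ⁆ w∈)
        where
        w∉ : ¬ (w ∈ U ⊎ w ∈ ⁅ v ⁆)
        w∉ (inj₁ w∈U) = x∉p-x (V C - v) w (U⊆W w∈U)
        w∉ (inj₂ w∈v) = v≢w (sym (x∈⁅y⁆⇒x≡y v w∈v))
      sparse′ : (span C U + ∣ nbrs C v ∩ U ∣) + 3 ≤ 2 * suc ∣ U ∣
      sparse′ = subst₂ (λ s n → s + 3 ≤ 2 * n) (span-∪⁅⁆ C v∉U) (∣∪⁅⁆∣ v∉U)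
        (sparse (U ∪ ⁅ v ⁆) U+v⊂V (2≤∣p∣ (x∈p∪q⁺ (inj₁ a∈U)) (x∈p∪q⁺ (inj₁ b∈U)) a≢b))
      3≤d : 3 ≤ ∣ nbrs C v ∩ U ∣
      3≤d = ≤-trans (s≤s (2≤∣p∣ (x∈p∧x≢y⇒x∈p-y (x∈p∩q⁺ (b∈ , b∈U)) (a≢b ∘ sym)) (x∈p∧x≢y⇒x∈p-y (x∈p∩q⁺ (c∈ , c∈U)) (a≢c ∘ sym)) b≢c))
        (≤-reflexive (sym (∣p∣≡1+∣p-x∣ (x∈p∩q⁺ (a∈ , a∈U)))))
      eq₁ : ∀ s u d → (((s + d) + 3) + 2 * u) + 3 ≡ 6 + (s + 2 * u + d)
      eq₁ = solve-∀
      eq₂ : ∀ s u d → (2 * suc u + (s + 3)) + d ≡ 5 + (s + 2 * u + d)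
      eq₂ = solve-∀
    among : ∀ {a b c} → a ∈ nbrs C v → b ∈ nbrs C v → c ∈ nbrs C v → a ≢ b → a ≢ c → b ≢ c →
      ∃[ x ] ∃[ y ] x ∈ W × y ∈ W × x ≢ y × ¬ (∃[ Z ] Joined W x y Z)
    among {a} {b} {c} a∈ b∈ c∈ a≢b a≢c b≢c with joined? W a b | joined? W a c | joined? W b c
    ... | no ¬ab | _      | _      = a , b , nbrs⊆W a∈ , nbrs⊆W b∈ , a≢b , ¬ab
    ... | yes _  | no ¬ac | _      = a , c , nbrs⊆W a∈ , nbrs⊆W c∈ , a≢c , ¬ac
    ... | yes _  | yes _  | no ¬bc = b , c , nbrs⊆W b∈ , nbrs⊆W c∈ , b≢c , ¬bc
    ... | yes (Z₁ , Z₁⊆W , a∈Z₁ , b∈Z₁ , t₁) | yes (Z₂ , Z₂⊆W , a∈Z₂ , c∈Z₂ , t₂) | yes (Z₃ , Z₃⊆W , b∈Z₃ , c∈Z₃ , t₃) =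
      let U , U⊆W , tU , a∈U , b∈U , c∈U = tight-triangle {W} {Z₁} {Z₂} {Z₃} W⊂V Z₁⊆W Z₂⊆W Z₃⊆W
                                             t₁ t₂ t₃ a∈Z₁ b∈Z₁ a∈Z₂ c∈Z₂ b∈Z₃ c∈Z₃ b≢c
      in ⊥-elim (too-dense a∈ b∈ c∈ a≢b a≢c b≢c {U} U⊆W tU a∈U b∈U c∈U)

  -- Well-founded descent along strict inclusion. Minimality is required only among sets containing
  -- both `x` and `y`, since those are the sets in which an added edge `xy` counts.
  minimal-tight : ∀ {x y} S → x ∈ S → y ∈ S → Tight S →
    ∃[ X ] X ⊆ S × x ∈ X × y ∈ X × Tight X × (∀ {Z} → Z ⊂ X → x ∈ Z → y ∈ Z → ¬ Tight Z)
  minimal-tight {x} {y} S = descend S (⊂-wellFounded S)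
    where
    descend : ∀ S → Acc _⊂_ S → x ∈ S → y ∈ S → Tight S →
      ∃[ X ] X ⊆ S × x ∈ X × y ∈ X × Tight X × (∀ {Z} → Z ⊂ X → x ∈ Z → y ∈ Z → ¬ Tight Z)
    descend S (acc smaller) x∈S y∈S tS
      with anySubset? (λ Z → (Z ⊂? S) ×-dec (x ∈? Z) ×-dec (y ∈? Z) ×-dec (2 * ∣ Z ∣ ≤? span C Z + 3))
    ... | no none = S , id , x∈S , y∈S , tS , λ {Z} Z⊂S x∈Z y∈Z tZ → none (Z , Z⊂S , x∈Z , y∈Z , tZ)
    ... | yes (Z , Z⊂S , x∈Z , y∈Z , tZ) =
      let X , X⊆Z , rest = descend Z (smaller Z⊂S) x∈Z y∈Z tZ
      in X , (λ z∈ → proj₁ Z⊂S (X⊆Z z∈)) , rest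

  -- The induced subgraph on `X` with the edge `xy` added

  module AddEdge {x y : Fin N} (x≢y : x ≢ y) (¬xy : ¬ Adj C x y) (X : Subset N) where

    xy? : ∀ p q → Dec (p ≡ x × q ≡ y)
    xy? p q = (p ≟ x) ×-dec (q ≟ y)

    ¬xy×yx : ∀ {p q} → ¬ ((p ≡ x × q ≡ y) × (q ≡ x × p ≡ y))
    ¬xy×yx ((p≡x , _) , (_ , p≡y)) = x≢y (trans (sym p≡x) p≡y)

    D : Graph N
    D = record
      { adj        = λ p q → inside₂ C X p q ∨ (does (xy? p q) ∨ does (xy? q p))
      ; adj-sym    = λ p q → cong₂ _∨_ (inside₂-sym C X p q) (∨-comm (does (xy? p q)) (does (xy? q p)))
      ; adj-irrefl = λ p → cong₂ _∨_ (cong (_∧ (lookup X p ∧ lookup X p)) (adj-irrefl C p))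
                       (cong₂ _∨_ (dec-false (xy? p p) (λ e → ¬xy×yx (e , e))) (dec-false (xy? p p) (λ e → ¬xy×yx (e , e))))
      }

    AdjD⁻ : ∀ {p q} → Adj D p q → (Adj C p q × p ∈ X × q ∈ X) ⊎ SameEdge (p , q) (x , y)
    AdjD⁻ {p} {q} pq with Equivalence.to (T-∨ {inside₂ C X p q}) pq
    ... | inj₁ old = inj₁ (∈inside₂⁻ C X old)
    ... | inj₂ new with Equivalence.to (T-∨ {does (xy? p q)}) new
    ...   | inj₁ xy = inj₂ (inj₁ (T-does⁻ (xy? p q) xy))
    ...   | inj₂ yx = inj₂ (inj₂ (swap (T-does⁻ (xy? q p) yx)))

    AdjD-old : ∀ {p q} → Adj C p q → p ∈ X → q ∈ X → Adj D p q
    AdjD-old pq p∈X q∈X = Equivalence.from T-∨ (inj₁ (∈inside₂⁺ C X pq p∈X q∈X))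

    AdjD-new : Adj D x y
    AdjD-new = Equivalence.from (T-∨ {inside₂ C X x y}) (inj₂ (Equivalence.from T-∨ (inj₁ (T-does⁺ (xy? x y) (refl , refl)))))

    -- Restricting to `X` loses no edge inside `S ⊆ X`, and as `x` and `y` are nonadjacent in `C`
    -- the added edge is not counted already.
    span-D : ∀ {S} → S ⊆ X → span D S ≡ span C S + ⟦ lookup S x ∧ lookup S y ⟧
    span-D {S} S⊆X = ℕ.*-cancelˡ-≡ _ _ 2 (begin
      2 * span D S
        ≡⟨ 2*span D S ⟩
      ∑∑ (λ p q → ⟦ inside₂ D S p q ⟧)
        ≡⟨ ∑∑-cong {N} pointwise ⟩
      ∑∑ (λ p q → ⟦ inside₂ C S p q ⟧ + (δ p q + δ q p))
        ≡⟨ trans (∑∑-distrib-+ {N} (λ p q → ⟦ inside₂ C S p q ⟧) _)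
                 (cong (∑∑ (λ p q → ⟦ inside₂ C S p q ⟧) +_) (∑∑-distrib-+ δ (λ p q → δ q p))) ⟩
      ∑∑ (λ p q → ⟦ inside₂ C S p q ⟧) + (∑∑ δ + ∑∑ (λ p q → δ q p))
        ≡⟨ cong₂ _+_ (sym (2*span C S)) (cong₂ _+_ ∑∑δ (trans (∑-comm {N} {N} (λ p q → δ q p)) ∑∑δ)) ⟩
      2 * span C S + (⟦ lookup S x ∧ lookup S y ⟧ + ⟦ lookup S x ∧ lookup S y ⟧)
        ≡⟨ double (span C S) ⟦ lookup S x ∧ lookup S y ⟧ ⟩
      2 * (span C S + ⟦ lookup S x ∧ lookup S y ⟧) ∎)
      where
      open ≡-Reasoning
      double : ∀ s d → 2 * s + (d + d) ≡ 2 * (s + d)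
      double = solve-∀
      δ : Fin N → Fin N → ℕ
      δ p q = ⟦ does (xy? p q) ∧ (lookup S p ∧ lookup S q) ⟧
      ∑∑δ : ∑∑ δ ≡ ⟦ lookup S x ∧ lookup S y ⟧
      ∑∑δ = begin
        ∑∑ δ
          ≡⟨ ∑∑-cong {N} (λ p q → cong ⟦_⟧ (∧-assoc (does (p ≟ x)) (does (q ≟ y)) (lookup S p ∧ lookup S q))) ⟩
        ∑∑ (λ p q → ⟦ does (p ≟ x) ∧ (does (q ≟ y) ∧ (lookup S p ∧ lookup S q)) ⟧)
          ≡⟨ ∑∑-δˡ x (λ p q → does (q ≟ y) ∧ (lookup S p ∧ lookup S q)) ⟩
        ∑[ q < N ] ⟦ does (q ≟ y) ∧ (lookup S x ∧ lookup S q) ⟧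
          ≡⟨ ∑-δ y (λ q → lookup S x ∧ lookup S q) ⟩
        ⟦ lookup S x ∧ lookup S y ⟧ ∎
      -- Here `g` stands for an edge of `C`, `e` and `e′` for the two orientations of the new edge,
      -- and `i` and `s` for a pair inside `X` and inside `S`.
      disjoint-cases : ∀ g e e′ i s → ¬ (T g × T e) → ¬ (T g × T e′) → ¬ (T e × T e′) → (T s → T i) →
        ⟦ ((g ∧ i) ∨ (e ∨ e′)) ∧ s ⟧ ≡ ⟦ g ∧ s ⟧ + (⟦ e ∧ s ⟧ + ⟦ e′ ∧ s ⟧)
      disjoint-cases g e e′ i false _ _ _ _
        rewrite ∧-zeroʳ ((g ∧ i) ∨ (e ∨ e′)) | ∧-zeroʳ g | ∧-zeroʳ e | ∧-zeroʳ e′ = refl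
      disjoint-cases g     e     e′    false true _  _   _   s⇒i = ⊥-elim (s⇒i _)
      disjoint-cases true  true  _     true  true ge _   _   _   = contradiction _ ge
      disjoint-cases true  false true  true  true _  ge′ _   _   = contradiction _ ge′
      disjoint-cases true  false false true  true _  _   _   _   = refl
      disjoint-cases false true  true  true  true _  _   ee′ _   = contradiction _ ee′
      disjoint-cases false true  false true  true _  _   _   _   = refl
      disjoint-cases false false true  true  true _  _   _   _   = refl
      disjoint-cases false false false true  true _  _   _   _   = refl
      pointwise : ∀ p q → ⟦ inside₂ D S p q ⟧ ≡ ⟦ inside₂ C S p q ⟧ + (δ p q + δ q p)
      pointwise p q rewrite ∧-comm (lookup S q) (lookup S p) = disjoint-cases
        (adj C p q) (does (xy? p q)) (does (xy? q p)) (lookup X p ∧ lookup X q) (lookup S p ∧ lookup S q)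
        (λ (pq , e) → old (T-does⁻ (xy? p q) e) pq)
        (λ (pq , e) → old (T-does⁻ (xy? q p) e) (Adj-sym C pq))
        (λ (e , e′) → ¬xy×yx (T-does⁻ (xy? p q) e , T-does⁻ (xy? q p) e′))
        λ t → let p∈S , q∈S = Equivalence.to (T-∧ {lookup S p}) t in Equivalence.from T-∧ (mono p∈S , mono q∈S)
        where
        old : ∀ {p q} → p ≡ x × q ≡ y → ¬ Adj C p q
        old (refl , refl) = ¬xy
        mono : ∀ {p} → T (lookup S p) → T (lookup X p)
        mono {p} t = Equivalence.from T-≡ ([]=⇒lookup (S⊆X (lookup⇒[]= p S (Equivalence.to T-≡ t))))

    module _ (X⊂V : X ⊂ V C) (x∈X : x ∈ X) (y∈X : y ∈ X) (tight : Tight X)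
             (minimal : ∀ {Z} → Z ⊂ X → x ∈ Z → y ∈ Z → ¬ Tight Z) where

      -- An isolated vertex of D could be dropped from X, contradicting sparsity of the rest.
      V-D : V D ≡ X
      V-D = ⊆-antisym V⊆X X⊆V
        where
        V⊆X : V D ⊆ X
        V⊆X z∈ with AdjD⁻ (proj₂ (∈V⁻ D z∈))
        ... | inj₁ (_ , z∈X , _)       = z∈X
        ... | inj₂ (inj₁ (refl , _))   = x∈X
        ... | inj₂ (inj₂ (refl , _))   = y∈X
        X⊆V : X ⊆ V D
        X⊆V {z} z∈X with z ∈? V D
        ... | yes z∈V = z∈V
        ... | no  z∉V = ⊥-elim (ℕ.<⇒≱ {2 * ∣ X - z ∣} {2 * ∣ X ∣} (ℕ.*-monoʳ-< 2 (x∈p⇒∣p-x∣<∣p∣ z∈X)) (begin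
            2 * ∣ X ∣                                             ≤⟨ tight ⟩
            span C X + 3                                          ≡⟨ cong (_+ 3) (span-remove C z∈X) ⟩
            (span C (X - z) + ∣ nbrs C z ∩ (X - z) ∣) + 3         ≡⟨ cong (λ d → (span C (X - z) + d) + 3) isolated ⟩
            (span C (X - z) + 0) + 3                              ≡⟨ cong (_+ 3) (+-identityʳ (span C (X - z))) ⟩
            span C (X - z) + 3                                    ≤⟨ sparse (X - z) (⊆-⊂-trans (p─q⊆p X ⁅ z ⁆) X⊂V)
                                                                       (2≤∣p∣ (x∈p∧x≢y⇒x∈p-y x∈X x≢z) (x∈p∧x≢y⇒x∈p-y y∈X y≢z) x≢y) ⟩
            2 * ∣ X - z ∣                                         ∎))
          where
          open ≤-Reasoning
          x≢z : x ≢ z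
          x≢z refl = z∉V (∈V⁺ D AdjD-new)
          y≢z : y ≢ z
          y≢z refl = z∉V (∈V⁺ D (Adj-sym D AdjD-new))
          isolated : ∣ nbrs C z ∩ (X - z) ∣ ≡ 0
          isolated = trans (cong ∣_∣ (Empty-unique λ (q , q∈) →
            let q∈nbrs , q∈X-z = x∈p∩q⁻ (nbrs C z) (X - z) q∈
            in z∉V (∈V⁺ D (AdjD-old (∈nbrs⁻ C q∈nbrs) z∈X (proj₁ (x∈p-y⁻ X z q∈X-z)))))) (∣⊥∣≡0 N)

      -- The new edge raises the count of the tight set `X` from 2|X| - 3 to 2|X| - 2. A proper
      -- subset containing `x` and `y` is not tight by minimality and so has room for the new edge;
      -- every other one keeps its count from `C`.
      D-circuit : IsRigidityCircuit D
      D-circuit = record { edge-count = count ; sparse = sparse-D }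
        where
        count : length (E D) + 2 ≡ 2 * ∣ V D ∣
        count = begin
          length (E D) + 2                                    ≡⟨ cong (_+ 2) (span-all D (⊆-reflexive V-D)) ⟨
          span D X + 2                                        ≡⟨ cong (_+ 2) (span-D id) ⟩
          (span C X + ⟦ lookup X x ∧ lookup X y ⟧) + 2
            ≡⟨ cong₂ (λ a b → (span C X + ⟦ a ∧ b ⟧) + 2) ([]=⇒lookup x∈X) ([]=⇒lookup y∈X) ⟩
          (span C X + 1) + 2                                  ≡⟨ ℕ.+-assoc (span C X) 1 2 ⟩
          span C X + 3                                        ≡⟨ ℕ.≤-antisym (sparse X X⊂V (2≤∣p∣ x∈X y∈X x≢y)) tight ⟩
          2 * ∣ X ∣                                           ≡⟨ cong (λ S → 2 * ∣ S ∣) V-D ⟨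
          2 * ∣ V D ∣                                         ∎
          where open ≡-Reasoning
        sparse-D : ∀ S → S ⊂ V D → 2 ≤ ∣ S ∣ → span D S + 3 ≤ 2 * ∣ S ∣
        sparse-D S S⊂V 2≤ rewrite span-D {S} (proj₁ (subst (S ⊂_) V-D S⊂V)) with x ∈? S | y ∈? S
        ... | yes x∈S | yes y∈S rewrite []=⇒lookup x∈S | []=⇒lookup y∈S | ℕ.+-assoc (span C S) 1 3 | ℕ.+-suc (span C S) 3 =
          ℕ.≰⇒> (minimal (subst (S ⊂_) V-D S⊂V) x∈S y∈S)
        ... | no x∉S  | _ rewrite ∉⇒lookup x∉S | +-identityʳ (span C S) =
          sparse S (⊂-trans (subst (S ⊂_) V-D S⊂V) X⊂V) 2≤
        ... | yes _   | no y∉S rewrite ∉⇒lookup y∉S | ∧-zeroʳ (lookup S x) | +-identityʳ (span C S) =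
          sparse S (⊂-trans (subst (S ⊂_) V-D S⊂V) X⊂V) 2≤

  -- Splitting a circuit into two smaller circuits

  -- The strict drop in vertex count serves both as the induction measure and as the source of the
  -- level bound.
  Resolution : Set
  Resolution = ∃[ D₁ ] ∃[ D₂ ] ∃[ x ] ∃[ y ] IsRigidityCircuit D₁ × IsRigidityCircuit D₂ ×
    ∣ V D₁ ∣ < ∣ V C ∣ × ∣ V D₂ ∣ < ∣ V C ∣ × IsCR C D₁ D₂ x y

  -- The two ends of an edge already form a tight set: 2 · 2 = 1 + 3.
  unjoined⇒nonadjacent : ∀ {W x y} → x ∈ W → y ∈ W → x ≢ y → ¬ (∃[ Z ] Joined W x y Z) → ¬ Adj C x y
  unjoined⇒nonadjacent {W} {x} {y} x∈W y∈W x≢y unjoined xy =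
    unjoined (⁅ x ⁆ ∪ ⁅ y ⁆ , ∪-⊆ (λ z∈ → subst (_∈ W) (sym (x∈⁅y⁆⇒x≡y x z∈)) x∈W) (λ z∈ → subst (_∈ W) (sym (x∈⁅y⁆⇒x≡y y z∈)) y∈W) ,
              x∈p∪q⁺ (inj₁ (x∈⁅x⁆ x)) , x∈p∪q⁺ (inj₂ (x∈⁅x⁆ y)) , tight)
    where
    open ≤-Reasoning
    y∉x : y ∉ ⁅ x ⁆
    y∉x = x≢y⇒x∉⁅y⁆ (x≢y ∘ sym)
    tight : Tight (⁅ x ⁆ ∪ ⁅ y ⁆)
    tight = begin
      2 * ∣ ⁅ x ⁆ ∪ ⁅ y ⁆ ∣                               ≡⟨ cong (2 *_) (trans (∣∪⁅⁆∣ y∉x) (cong suc (∣⁅x⁆∣≡1 x))) ⟩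
      1 + 3                                               ≡⟨ cong (_+ 3) (∣⁅x⁆∣≡1 x) ⟨
      ∣ ⁅ x ⁆ ∣ + 3
        ≤⟨ ℕ.+-monoˡ-≤ 3 (p⊆q⇒∣p∣≤∣q∣ λ z∈ → x∈p∩q⁺
             (subst (_∈ nbrs C y) (sym (x∈⁅y⁆⇒x≡y x z∈)) (∈nbrs⁺ C (Adj-sym C xy)) , z∈)) ⟩
      ∣ nbrs C y ∩ ⁅ x ⁆ ∣ + 3                            ≤⟨ ℕ.+-monoˡ-≤ 3 (ℕ.m≤n+m _ (span C ⁅ x ⁆)) ⟩
      (span C ⁅ x ⁆ + ∣ nbrs C y ∩ ⁅ x ⁆ ∣) + 3           ≡⟨ cong (_+ 3) (span-∪⁅⁆ C y∉x) ⟨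
      span C (⁅ x ⁆ ∪ ⁅ y ⁆) + 3                          ∎

  -- Nonadjacency puts all neighbours of `v` into `W`, and degree 3 makes `V C - v` and `V C - w`
  -- tight, so the search for minimal tight sets can start from these two.
  resolve : ∀ {v w} → v ∈ cubic → w ∈ cubic → v ≢ w → ¬ Adj C v w → Resolution
  resolve {v} {w} v∈cubic w∈cubic v≢w ¬vw =
    let x , y , x∈W , y∈W , x≢y , unjoined = unjoined-nbrs v∈V w∈V v≢w (degree≥3 v∈V) nbrs⊆W
    in along x∈W y∈W x≢y unjoined
    where
    v∈V = cubic⊆V v∈cubic
    w∈V = cubic⊆V w∈cubic
    W = V C - v - w
    nbrs⊆W : nbrs C v ⊆ W
    nbrs⊆W z∈ = x∈p∧x≢y⇒x∈p-y (x∈p∧x≢y⇒x∈p-y (nbrs⊆V C v z∈) (Adj⇒≢ C (∈nbrs⁻ C z∈) ∘ sym))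
      λ { refl → ¬vw (∈nbrs⁻ C z∈) }
    W⊆V-v : W ⊆ V C - v
    W⊆V-v z∈ = proj₁ (x∈p-y⁻ (V C - v) w z∈)
    W⊆V-w : W ⊆ V C - w
    W⊆V-w z∈ = W′ (subst (_ ∈_) (p─x─y≡p─y─x (V C) v w) z∈)
      where
      W′ : V C - w - v ⊆ V C - w
      W′ z∈ = proj₁ (x∈p-y⁻ (V C - w) v z∈)

    along : ∀ {x y} → x ∈ W → y ∈ W → x ≢ y → ¬ (∃[ Z ] Joined W x y Z) → Resolution
    along {x} {y} x∈W y∈W x≢y unjoined =
      let X₁ , X₁⊆ , x∈X₁ , y∈X₁ , tight₁ , min₁ = minimal-tight (V C - v) (W⊆V-v x∈W) (W⊆V-v y∈W) (remove-tight v∈V (∈cubic⁻ v∈cubic))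
          X₂ , X₂⊆ , x∈X₂ , y∈X₂ , tight₂ , min₂ = minimal-tight (V C - w) (W⊆V-w x∈W) (W⊆V-w y∈W) (remove-tight w∈V (∈cubic⁻ w∈cubic))
      in resolution {X₁} {X₂} X₁⊆ x∈X₁ y∈X₁ tight₁ min₁ X₂⊆ x∈X₂ y∈X₂ tight₂ min₂
      where
      ¬xy : ¬ Adj C x y
      ¬xy = unjoined⇒nonadjacent x∈W y∈W x≢y unjoined
      resolution : ∀ {X₁ X₂} →
        X₁ ⊆ V C - v → x ∈ X₁ → y ∈ X₁ → Tight X₁ → (∀ {Z} → Z ⊂ X₁ → x ∈ Z → y ∈ Z → ¬ Tight Z) →
        X₂ ⊆ V C - w → x ∈ X₂ → y ∈ X₂ → Tight X₂ → (∀ {Z} → Z ⊂ X₂ → x ∈ Z → y ∈ Z → ¬ Tight Z) →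
        Resolution
      resolution {X₁} {X₂} X₁⊆ x∈X₁ y∈X₁ tight₁ min₁ X₂⊆ x∈X₂ y∈X₂ tight₂ min₂ =
        R₁.D , R₂.D , x , y ,
        R₁.D-circuit X₁⊂V x∈X₁ y∈X₁ tight₁ min₁ , R₂.D-circuit X₂⊂V x∈X₂ y∈X₂ tight₂ min₂ ,
        subst (λ S → ∣ S ∣ < ∣ V C ∣) (sym V₁) (p⊂q⇒∣p∣<∣q∣ X₁⊂V) ,
        subst (λ S → ∣ S ∣ < ∣ V C ∣) (sym V₂) (p⊂q⇒∣p∣<∣q∣ X₂⊂V) ,
        record
          { distinct = distinct
          ; common₁  = R₁.AdjD-new
          ; common₂  = R₂.AdjD-new
          ; vertices = trans (sym U≡V) (sym (cong₂ _∪_ V₁ V₂))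
          ; edges    = λ p q → mk⇔ (to p q) from
          }
        where
        module R₁ = AddEdge x≢y ¬xy X₁
        module R₂ = AddEdge x≢y ¬xy X₂
        X₁⊂V : X₁ ⊂ V C
        X₁⊂V = ⊆-⊂-trans X₁⊆ (x∈p⇒p-x⊂p v∈V)
        X₂⊂V : X₂ ⊂ V C
        X₂⊂V = ⊆-⊂-trans X₂⊆ (x∈p⇒p-x⊂p w∈V)
        V₁ : V R₁.D ≡ X₁
        V₁ = R₁.V-D X₁⊂V x∈X₁ y∈X₁ tight₁ min₁
        V₂ : V R₂.D ≡ X₂
        V₂ = R₂.V-D X₂⊂V x∈X₂ y∈X₂ tight₂ min₂
        U = X₁ ∪ X₂
        I = X₁ ∩ X₂

        ⊆W : ∀ {z} → z ∈ X₁ → z ∈ X₂ → z ∈ W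
        ⊆W z∈X₁ z∈X₂ = x∈p∧x≢y⇒x∈p-y (X₁⊆ z∈X₁) (proj₂ (x∈p-y⁻ (V C) w (X₂⊆ z∈X₂)))

        -- `X₁` misses `v` and `X₂` misses `w`, so `I` lies in `W`; were it tight, it would join `x`
        -- and `y`.
        I-loose : span C I + 3 < 2 * ∣ I ∣
        I-loose = ℕ.≰⇒> λ tI → unjoined (I ,
          (λ z∈ → let z∈X₁ , z∈X₂ = x∈p∩q⁻ X₁ X₂ z∈ in ⊆W z∈X₁ z∈X₂) ,
          x∈p∩q⁺ (x∈X₁ , x∈X₂) , x∈p∩q⁺ (y∈X₁ , y∈X₂) , tI)

        -- `k` is the surplus in supermodularity. The strictness of `I-loose` improves the constant
        -- 3 of a tight union to 2.
        U-dense : ∀ k → k + (span C X₁ + span C X₂) ≤ span C U + span C I → 2 * ∣ U ∣ + k ≤ span C U + 2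
        U-dense k super = cancel-common c
          (+-mono-≤ (+-mono-≤ (+-mono-≤ tight₁ tight₂) (+-mono-≤ I-loose super)) (≤-reflexive (cong (2 *_) (∣∪∣+∣∩∣ X₁ X₂))))
          (eq₁ k (∣ X₁ ∣) (∣ X₂ ∣) (∣ U ∣) (∣ I ∣) (span C X₁) (span C X₂) (span C I))
          (eq₂ (∣ X₁ ∣) (∣ X₂ ∣) (∣ I ∣) (span C X₁) (span C X₂) (span C U) (span C I))
          where
          c = 2 * ∣ X₁ ∣ + 2 * ∣ X₂ ∣ + 2 * ∣ I ∣ + (span C X₁ + span C X₂ + span C I + 4)
          eq₁ : ∀ k a b u i sa sb si → ((2 * a + 2 * b) + (suc (si + 3) + (k + (sa + sb)))) + 2 * (u + i) ≡
                (2 * u + k) + (2 * a + 2 * b + 2 * i + (sa + sb + si + 4))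
          eq₁ = solve-∀
          eq₂ : ∀ a b i sa sb su si → (((sa + 3) + (sb + 3)) + (2 * i + (su + si))) + 2 * (a + b) ≡
                (su + 2) + (2 * a + 2 * b + 2 * i + (sa + sb + si + 4))
          eq₂ = solve-∀

        -- With `k` = 0 the union spans at least 2|U| - 2 edges, one more than a proper subset may.
        U≡V : U ≡ V C
        U≡V = ⊆∧⊄⇒≡ (∪-⊆ (proj₁ X₁⊂V) (proj₁ X₂⊂V)) λ U⊂V → ℕ.<⇒≱
          (ℕ.+-monoʳ-< (span C U) {2} {3} ≤-refl)
          (≤-trans (sparse U U⊂V (2≤∣p∣ (x∈p∪q⁺ (inj₁ x∈X₁)) (x∈p∪q⁺ (inj₁ y∈X₁)) x≢y))
            (≤-trans (ℕ.m≤m+n _ 0) (U-dense 0 (span-supermodular C X₁ X₂))))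

        -- A crossing edge allows `k` = 1, and then `V C` would span at least 2n - 1 edges.
        no-crossing-edge : ∀ {p q} → Adj C p q → ¬ (p ∈ X₁ × q ∈ X₁) → ¬ (p ∈ X₂ × q ∈ X₂) → ⊥
        no-crossing-edge pq ∉₁ ∉₂ = ℕ.m+1+n≰m (2 * ∣ U ∣)
          (≤-trans (U-dense 1 (span-supermodular-< C X₁ X₂ pq (in-U pq) (in-U (Adj-sym C pq)) ∉₁ ∉₂))
            (≤-reflexive (subst (λ S → span C S + 2 ≡ 2 * ∣ S ∣) (sym U≡V) span-V)))
          where
          in-U : ∀ {p q} → Adj C p q → p ∈ U
          in-U pq = subst (_ ∈_) (sym U≡V) (∈V⁺ C pq)

        to : ∀ p q → Adj C p q → (Adj R₁.D p q ⊎ Adj R₂.D p q) × ¬ SameEdge (p , q) (x , y)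
        to p q pq = covered ((p ∈? X₁) ×-dec (q ∈? X₁)) ((p ∈? X₂) ×-dec (q ∈? X₂)) , not-new
          where
          covered : Dec (p ∈ X₁ × q ∈ X₁) → Dec (p ∈ X₂ × q ∈ X₂) → Adj R₁.D p q ⊎ Adj R₂.D p q
          covered (yes (p∈ , q∈)) _ = inj₁ (R₁.AdjD-old pq p∈ q∈)
          covered (no _) (yes (p∈ , q∈)) = inj₂ (R₂.AdjD-old pq p∈ q∈)
          covered (no ∉₁) (no ∉₂) = ⊥-elim (no-crossing-edge pq ∉₁ ∉₂)
          not-new : ¬ SameEdge (p , q) (x , y)
          not-new (inj₁ (refl , refl)) = ¬xy pq
          not-new (inj₂ (refl , refl)) = ¬xy (Adj-sym C pq)

        from : ∀ {p q} → (Adj R₁.D p q ⊎ Adj R₂.D p q) × ¬ SameEdge (p , q) (x , y) → Adj C p q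
        from (inj₁ pq , old) with R₁.AdjD⁻ pq
        ... | inj₁ (pq , _) = pq
        ... | inj₂ same     = contradiction same old
        from (inj₂ pq , old) with R₂.AdjD⁻ pq
        ... | inj₁ (pq , _) = pq
        ... | inj₂ same     = contradiction same old

        -- Equal graphs would give `X₁ ⊆ X₂`, hence `X₁ ⊆ W`, and the tight set `X₁` would join `x`
        -- and `y`.
        distinct : ¬ (R₁.D ≈ R₂.D)
        distinct D₁≈D₂ = unjoined (X₁ , (λ z∈ → ⊆W z∈ (X₁⊆X₂ z∈)) , x∈X₁ , y∈X₁ , tight₁)
          where
          X₁⊆X₂ : X₁ ⊆ X₂
          X₁⊆X₂ {z} z∈ = let q , zq = ∈V⁻ R₁.D (subst (z ∈_) (sym V₁) z∈) in
            subst (z ∈_) V₂ (∈V⁺ R₂.D (subst T (D₁≈D₂ z q) zq))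

  K₄-or-resolution : IsK₄ C ⊎ Resolution
  K₄-or-resolution with K₄-or-independent-cubic
  ... | inj₁ K₄                                   = inj₁ K₄
  ... | inj₂ (v , w , v∈ , w∈ , v≢w , ¬vw)        = inj₂ (resolve v∈ w∈ v≢w ¬vw)

-- Assembling the resultant tree

module _ {N : ℕ} where

  leaf-tree : ∀ {C : Graph N} → IsRigidityCircuit C → IsK₄ C → IsResultantTree C (leaf C)
  leaf-tree circuit K₄ = record
    { root-is-C = refl
    ; circuits  = λ { here → circuit }
    ; levels    = λ { here → ≤-reflexive (+-identityʳ _) }
    ; internal  = λ ()
    ; leaves    = λ { here → K₄ }
    }

  node-tree : ∀ {C D₁ D₂ : Graph N} {x y t₁ t₂} → IsRigidityCircuit C → IsCR C D₁ D₂ x y →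
    ∣ V D₁ ∣ < ∣ V C ∣ → ∣ V D₂ ∣ < ∣ V C ∣ →
    IsResultantTree D₁ t₁ → IsResultantTree D₂ t₂ → IsResultantTree C (node C t₁ t₂)
  node-tree {C} {x = x} {y} circuit CR D₁<C D₂<C T₁ T₂ = record
    { root-is-C = refl
    ; circuits  = λ { here → circuit ; (left s) → T₁.circuits s ; (right s) → T₂.circuits s }
    -- Passing from a child to its parent raises the level by one, which is paid for by the vertex
    -- that the child lacks.
    ; levels    = λ { here → ≤-reflexive (+-identityʳ _)
                    ; (left s)  → ≤-trans (≤-reflexive (ℕ.+-suc _ _)) (≤-trans (s≤s (T₁.levels s)) D₁<C)
                    ; (right s) → ≤-trans (≤-reflexive (ℕ.+-suc _ _)) (≤-trans (s≤s (T₂.levels s)) D₂<C) }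
    ; internal  = λ { here → x , y , subst₂ (λ D₁ D₂ → IsCR C D₁ D₂ x y) (sym T₁.root-is-C) (sym T₂.root-is-C) CR
                    ; (left s) → T₁.internal s ; (right s) → T₂.internal s }
    ; leaves    = λ { (left s) → T₁.leaves s ; (right s) → T₂.leaves s }
    }
    where
    module T₁ = IsResultantTree T₁
    module T₂ = IsResultantTree T₂

  -- Strong induction on the number of vertices; the tree and the derivation from copies of K₄ come
  -- from the same recursive calls.
  resultant-tree : ∀ (C : Graph N) → Acc _<_ ∣ V C ∣ → IsRigidityCircuit C → (∃[ t ] IsResultantTree C t) × ObtainableFromK₄ C
  resultant-tree C (acc smaller) circuit with Circuit.K₄-or-resolution C circuit
  ... | inj₁ K₄ = (leaf C , leaf-tree circuit K₄) , base K₄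
  ... | inj₂ (D₁ , D₂ , x , y , circuit₁ , circuit₂ , D₁<C , D₂<C , CR) =
    let (t₁ , T₁) , O₁ = resultant-tree D₁ (smaller D₁<C) circuit₁
        (t₂ , T₂) , O₂ = resultant-tree D₂ (smaller D₂<C) circuit₂
    in (node C t₁ t₂ , node-tree circuit CR D₁<C D₂<C T₁ T₂) , step O₁ O₂ CR

theorem1 : ∀ (N : ℕ) (C : Graph N) → IsRigidityCircuit C →
    (∃[ t ] IsResultantTree C t) × ObtainableFromK₄ C
theorem1 N C = resultant-tree C (<-wellFounded ∣ V C ∣)
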